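{- Let $\alpha$ be a $\mathbf{cds}$-non-sortable permutation (equivalently, one with nonempty strategic pile), and let $\mathsf{P}$ be the strategic pile of $\alpha$. Let $j\in\{0,1,2,3\}$ with $|\mathsf{P}| \bmod 4 = j$. (1)(a) If $j<2$, then for any $\mathsf{A}\subseteq\mathsf{P}$ with $|\mathsf{A}|\ge \frac34(|\mathsf{P}|-j)+j$, ONE has a winning strategy in $\mathsf{CDS}(\alpha,\mathsf{A})$. (1)(b) If $j\ge 2$, then for any $\mathsf{A}\subseteq\mathsf{P}$ with $|\mathsf{A}|\ge \frac34(|\mathsf{P}|-j)+(j-1)$, ONE has a winning strategy in $\mathsf{CDS}(\alpha,\mathsf{A})$. (2) For any $\mathsf{A}\subseteq\mathsf{P}$ with $|\mathsf{P}\setminus\mathsf{A}|\ge \frac34(|\mathsf{P}|-j)+j$, TWO has a winning strategy in $\mathsf{CDS}(\alpha,\mathsf{A})$.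
   Context: **Permutations and pointers.** $\mathsf{S}_n$ is the set of permutations of $\{1,\dots,n\}$, written as lists $\alpha=[a_1,\dots,a_n]$; all permutations considered lie in some $\mathsf{S}_n$. An entry $k$ of $\alpha$ has a head pointer $(k,k+1)$, placed immediately to the right of $k$, and a tail pointer $(k-1,k)$, placed immediately to the left of $k$. The pointers $(0,1)$ and $(n,n+1)$ are disregarded, so $\alpha$ has the $n-1$ pointers $(i,i+1)$, $1\le i\le n-1$, each occurring exactly twice: just to the right of $i$ and just to the left of $i+1$. In the gap between two consecutive entries $e,f$, the head pointer of $e$ comes before the tail pointer of $f$. Two distinct pointers $p,q$ interlock in $\alpha$ if their four occurrences appear, from left to right, in the order $p\ldots q\ldots p\ldots q$ or $q\ldots p\ldots q\ldots p$. **The sorting operation cds.** If $p$ and $q$ interlock in $\alpha$, the four occurrences of $p$ and $q$ cut the list $\alpha$ into five consecutive (possibly empty) blocks of entries $\alpha=A\,B\,C\,D\,E$ ($B$ between the first and second occurrences, $C$ between the second and third, $D$ between the third and fourth), and $\mathbf{cds}_{p,q}(\alpha)$ is the permutation $A\,D\,C\,B\,E$. If $p,q$ do not interlock, $\mathbf{cds}_{p,q}(\alpha)$ is undefined. A $\mathbf{cds}$ fixed point is a permutation with no interlocking pair of pointers; the fixed points in $\mathsf{S}_n$ are the identity and the permutations $[i,i+1,\dots,n,1,2,\dots,i-1]$ for $2\le i\le n$; the code of the latter is the pointer $(i-1,i)$. A permutation is $\mathbf{cds}$-sortable if the identity can be reached from it by applications of $\mathbf{cds}$. **Cycle graph and strategic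 pile.** The cycle graph of $\alpha=[a_1,\dots,a_n]$ has vertices $0,1,\dots,n+1$; a dotted directed edge from $i$ to $i+1$ for each $0\le i\le n$; and, with $a_0=0$, $a_{n+1}=n+1$, a black directed edge from $a_k$ to $a_{k-1}$ for each $1\le k\le n+1$. The edge set decomposes uniquely into edge-disjoint directed alternating cycles (cycles in which dotted and black edges alternate). If the dotted edges $n\to n+1$ and $0\to1$ lie on the same alternating cycle, the strategic pile of $\alpha$ is the set of pointers $(i,i+1)$, $1\le i\le n-1$, such that the dotted edge $i\to i+1$ lies on the directed alternating path that starts with the dotted edge $n\to n+1$ and follows the cycle to the dotted edge $0\to1$; otherwise the strategic pile is empty. It is known that $\alpha$ is $\mathbf{cds}$-sortable if and only if its strategic pile is empty, and that for $2\le i\le n$ the fixed point $[i,\dots,n,1,\dots,i-1]$ is reachable from $\alpha$ by $\mathbf{cds}$ operations if and only if $(i-1,i)$ is in the strategic pile. **The game $\mathsf{CDS}(\alpha,\mathsf{A})$.** Here $\alpha$ is a $\mathbf{cds}$-non-sortable permutation with strategic pile $\mathsf{P}$, and $\mathsf{A}\subseteq\mathsf{P}$. Starting from $\alpha$, players ONE and TWO alternate, ONE moving first; each move consists of applying some $\mathbf{cds}_{p,q}$, with $p,q$ interlocking in the current permutation, to the current permutation. The game ends when a $\mathbf{cds}$ fixed point is reached. If the code of this fixed point (necessarily an element of $\mathsf{P}$) is in $\mathsf{A}$, ONE wins; otherwise TWO wins. -}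

module Defs where

open import Data.Fin.Base using (Fin; toℕ)
open import Data.Fin.Subset using (Subset; _∈_)
open import Data.List.Base using (List; []; _∷_; [_]; _++_; concatMap; applyUpTo)
import Data.List.Membership.Propositional as List
open import Data.List.Relation.Binary.Permutation.Propositional using (_↭_)
open import Data.Nat.Base using (ℕ; suc; pred; _+_; _∸_; _≤_)
open import Data.Product.Base using (_×_; ∃; ∃₂; Σ-syntax; _,_)
open import Data.Sum.Base using (_⊎_; inj₁; inj₂)
open import Function.Bundles using (_⇔_)
open import Relation.Binary.Construct.Closure.ReflexiveTransitive using (Star)
open import Relation.Binary.PropositionalEquality using (_≡_; _≢_)
open import Relation.Nullary.Negation using (¬_)

-- [1,…,n]
identity : ℕ → List ℕ
identity n = applyUpTo suc n

IsPermutation : ℕ → List ℕ → Set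
IsPermutation n α = α ↭ identity n

-- The pointer (i,i+1) is labelled i; the element p of Pointer n stands for
-- the pointer labelled suc (toℕ p), so the labels run over 1,…,n-1.
Pointer : ℕ → Set
Pointer n = Fin (n ∸ 1)

label : ∀ {m} → Fin m → ℕ
label p = suc (toℕ p)

data Token : Set where
  ptr   : ℕ → Token
  entry : ℕ → Token

-- Each entry k is preceded by its tail pointer (k-1,k) and followed by its
-- head pointer (k,k+1).  The tokens ptr 0 and ptr n also occur, but they are
-- not the label of any element of Pointer n.
marked : List ℕ → List Token
marked = concatMap λ k → ptr (pred k) ∷ entry k ∷ ptr k ∷ []

entries : List Token → List ℕ
entries []             = []
entries (ptr _   ∷ ts) = entries ts
entries (entry k ∷ ts) = k ∷ entries ts

-- The pattern p … q … p … q.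
record Alternation (p q : ℕ) (α : List ℕ) : Set where
  constructor alternation
  field
    A B C D E : List Token
    cut       : marked α ≡
                A ++ ptr p ∷ B ++ ptr q ∷ C ++ ptr p ∷ D ++ ptr q ∷ E

Interlock : ∀ {m} → Fin m → Fin m → List ℕ → Set
Interlock p q α =
  p ≢ q × (Alternation (label p) (label q) α ⊎ Alternation (label q) (label p) α)

exchange : ∀ {p q α} → Alternation p q α → List ℕ
exchange (alternation A B C D E _) =
  entries A ++ entries D ++ entries C ++ entries B ++ entries E

cds : ∀ {m} (p q : Fin m) {α} → Interlock p q α → List ℕ
cds p q (_ , inj₁ x) = exchange x
cds p q (_ , inj₂ x) = exchange x

Move : ℕ → List ℕ → List ℕ → Set
Move n α β = Σ[ p ∈ Pointer n ] Σ[ q ∈ Pointer n ] Σ[ x ∈ Interlock p q α ] β ≡ cds p q x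

FixedPoint : ℕ → List ℕ → Set
FixedPoint n α = (p q : Pointer n) → ¬ Interlock p q α

Sortable : ℕ → List ℕ → Set
Sortable n α = Star (Move n) α (identity n)

-- With c = label p, the fixed point [c+1,…,n,1,…,c] has code (c,c+1).
HasCode : ∀ n → List ℕ → Pointer n → Set
HasCode n α p =
  α ≡ applyUpTo (λ k → suc (label p + k)) (n ∸ label p) ++ applyUpTo suc (label p)

module CycleGraph (n : ℕ) (α : List ℕ) where

  Dotted : ℕ → ℕ → Set
  Dotted u v = u ≤ n × v ≡ suc u

  -- In [a₀,…,aₙ₊₁] = [0,a₁,…,aₙ,n+1], v immediately precedes u.
  Black : ℕ → ℕ → Set
  Black u v = ∃₂ λ xs ys → 0 ∷ α ++ [ suc n ] ≡ xs ++ v ∷ u ∷ ys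

  -- Path i es is the directed alternating path that starts with the dotted edge
  -- i → i+1 and stops on reaching the dotted edge 0 → 1 for the first time;
  -- es lists the sources of its dotted edges.  Each vertex has at most one
  -- outgoing edge of each kind, so for a permutation α the path follows the
  -- alternating cycle of its first edge, and exists iff 0 → 1 is on that cycle.
  data Path : ℕ → List ℕ → Set where
    stop : Path 0 (0 ∷ [])
    step : ∀ {i j k es} → i ≢ 0 → Dotted i j → Black j k → Path k es → Path i (i ∷ es)

IsStrategicPile : ∀ n → List ℕ → Subset (n ∸ 1) → Set
IsStrategicPile n α P =
  ∀ p → p ∈ P ⇔ (∃ λ es → CycleGraph.Path n α n es × label p List.∈ es)

-- Strategy trees for a player who wins exactly at the fixed points satisfying
-- Won: one move is selected at each of the player's own turns, every legal move
-- of the opponent is answered, and every leaf is a win.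
module _ (n : ℕ) (Won : List ℕ → Set) where

  mutual
    data PlayerToMove (α : List ℕ) : Set where
      over   : FixedPoint n α → Won α → PlayerToMove α
      choose : ∀ {β} → Move n α β → OpponentToMove β → PlayerToMove α

    data OpponentToMove (α : List ℕ) : Set where
      over   : FixedPoint n α → Won α → OpponentToMove α
      answer : ¬ FixedPoint n α → (∀ {β} → Move n α β → PlayerToMove β) →
               OpponentToMove α

CodeIn : ∀ n → Subset (n ∸ 1) → List ℕ → Set
CodeIn n A α = ∃ λ p → p ∈ A × HasCode n α p

OneHasWinningStrategy : ∀ n → List ℕ → Subset (n ∸ 1) → Set
OneHasWinningStrategy n α A = PlayerToMove n (CodeIn n A) α

TwoHasWinningStrategy : ∀ n → List ℕ → Subset (n ∸ 1) → Set
TwoHasWinningStrategy n α A = OpponentToMove n (λ β → ¬ CodeIn n A β) α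

{-# OPTIONS --safe #-}
module Submission where

-- On the dotted edges 0,…,n let f send y to the left neighbour of y+1 in
-- 0,a₁,…,aₙ,n+1; the alternating cycles are the cycles of f.  A move cds p q
-- turns p and q into fixed points of f and short-circuits the other cycles past
-- them, so the strategic pile loses p and q and nothing else.  A pointer (i,i+1)
-- interlocks with nothing only if i+1 directly follows i, or if α begins with i+1
-- and ends with i; the former is impossible in the pile, and the latter makes i
-- the only element of the pile.  Hence, while the pile has two or more elements,
-- every one of them can be removed by some move.  The player with a strategy thus
-- removes an undesired code at each turn, while a round costs at most four
-- elements of the pile, so that
--   4 · |undesired| ≤ |pile| + 2  before a move of this player, and
--   4 · |undesired| ≤ |pile|      before a move of the opponent
-- are preserved until no undesired code is left.

open import Defs
open import Data.Empty using (⊥)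
open import Data.Fin.Base using (Fin; zero; suc; toℕ; fromℕ<)
open import Data.Fin.Properties using (toℕ<n; toℕ-injective; toℕ-fromℕ<; any?)
import Data.Fin.Properties as Fin
open import Data.Fin.Subset using (Subset; _⊆_; _─_; _-_; _∩_; ∁; ⁅_⁆; ⊤; ∣_∣; inside; outside)
  renaming (_∈_ to _∈ˢ_; _∉_ to _∉ˢ_)
open import Data.Fin.Subset.Properties using
  ( p─q⊆p; ∣p─q∣≤∣p∣; p─⊥≡p; p─x─y≡p─y─x; x∈p∧x∉q⇒x∈p─q; x∈p∧x≢y⇒x∈p-y; x∈p⇒∣p-x∣<∣p∣
  ; x∈⁅x⁆; ∣⁅x⁆∣≡1; p⊆q⇒∣p∣≤∣q∣; x∈p∩q⁺; x∈p∩q⁻; x∈∁p⇒x∉p; x∉∁p⇒x∈p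
  ; nonempty?; ∈⊤; Empty-unique; ∣⊥∣≡0 )
  renaming (_∈?_ to _∈ˢ?_)
open import Data.List.Base using (List; []; _∷_; [_]; _++_; _∷ʳ_; applyUpTo; upTo; length)
open import Data.List.Membership.Propositional using (_∈_; _∉_)
open import Data.List.Membership.Propositional.Properties using
  (∈-++⁺ˡ; ∈-++⁺ʳ; ∈-++⁻; ∈-insert; ∈-∃++; ∈-applyUpTo⁺; ∈-applyUpTo⁻)
open import Data.List.Properties using
  ( ++-assoc; ++-identityʳ; ++-conicalˡ; ++-conicalʳ; ∷-injective; ∷-injectiveˡ; ∷-injectiveʳ
  ; ∷ʳ-injectiveʳ; concatMap-++; length-++; length-applyUpTo; applyUpTo-∷ʳ )
open import Data.List.Relation.Binary.Permutation.Propositional using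
  (_↭_; ↭-sym; ↭-trans; ↭-prep; ↭-reflexive; ↭⇒↭ₛ)
open import Data.List.Relation.Binary.Permutation.Propositional.Properties using
  (∈-resp-↭; ++⁺ˡ; ++⁺ʳ; shifts; ↭-length; ↭-empty-inv)
import Data.List.Relation.Binary.Permutation.Setoid.Properties as Permutation
import Data.List.Relation.Binary.Sublist.DecPropositional as DecSublist
import Data.List.Relation.Binary.Sublist.Propositional as Sublist
open import Data.List.Relation.Binary.Sublist.Propositional.Properties using ()
  renaming (++⁺ˡ to ⊆-++⁺ˡ)
open import Data.List.Relation.Unary.All as All using (All; []; _∷_)
open import Data.List.Relation.Unary.AllPairs using ([]; _∷_)
open import Data.List.Relation.Unary.Any using (here; there)
open import Data.List.Relation.Unary.Unique.Propositional using (Unique)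
open import Data.List.Relation.Unary.Unique.Propositional.Properties using (upTo⁺; applyUpTo⁺₁)
open import Data.Nat.Base using
  (ℕ; zero; suc; pred; _+_; _*_; _∸_; _≤_; _<_; _≥_; z≤n; s≤s; NonZero; >-nonZero⁻¹)
open import Data.Nat.DivMod using (_/_; _%_; m≡m%n+[m/n]*n; m*n/n≡m; m/n*n≤m)
open import Data.Nat.Induction using (<-wellFounded)
open import Data.Nat.Properties hiding (_≟_)
import Data.Nat.Properties as ℕ
open import Data.Nat.Tactic.RingSolver using (solve-∀)
open import Data.Product.Base using (_×_; ∃; ∃₂; _,_; proj₁; proj₂)
open import Data.Sum.Base as Sum using (_⊎_; inj₁; inj₂; [_,_]′; swap)
open import Data.Vec.Base using ([]; _∷_; here; there)
open import Function.Base using (_∘_)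
open import Function.Bundles using (mk⇔; Equivalence)
open import Induction.WellFounded using (Acc; acc)
open import Relation.Binary.Construct.Closure.ReflexiveTransitive using (ε; _◅_)
open import Relation.Binary.Definitions using (DecidableEquality)
open import Relation.Binary.PropositionalEquality using
  (_≡_; _≢_; refl; sym; trans; cong; cong₂; subst; setoid; module ≡-Reasoning)
open import Relation.Nullary.Decidable.Core using (Dec; yes; no; map′; _×-dec_; _⊎-dec_; ¬?)
open import Relation.Nullary.Negation using (¬_; contradiction)

-- Adjacent, first and last elements of lists.

module _ {X : Set} where

  Adjacent : X → X → List X → Set
  Adjacent v u w = ∃₂ λ xs ys → w ≡ xs ++ v ∷ u ∷ ys

  Begins Ends : List X → X → Set
  Begins w u = ∃ λ ys → w ≡ u ∷ ys
  Ends   w v = ∃ λ xs → w ≡ xs ∷ʳ v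

  begins-++ : ∀ {w u} v → Begins w u → Begins (w ++ v) u
  begins-++ v (ys , refl) = ys ++ v , refl

  ends-++ : ∀ v {w x} → Ends w x → Ends (v ++ w) x
  ends-++ v (xs , refl) = v ++ xs , sym (++-assoc v xs _)

  ends-++⁻ : ∀ v w {x} → Ends (v ++ w) x → Ends w x ⊎ w ≡ [] × Ends v x
  ends-++⁻ v [] (xs , eq) = inj₂ (refl , xs , trans (sym (++-identityʳ v)) eq)
  ends-++⁻ [] (y ∷ w) e = inj₁ e
  ends-++⁻ (z ∷ v) (y ∷ w) ([] , eq) with () ← ++-conicalʳ v (y ∷ w) (∷-injectiveʳ eq)
  ends-++⁻ (z ∷ v) (y ∷ w) (x ∷ xs , eq) with ends-++⁻ v (y ∷ w) (xs , ∷-injectiveʳ eq)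
  ... | inj₁ e = inj₁ e
  ... | inj₂ (() , _)

  begins-unique : ∀ {w u v} → Begins w u → Begins w v → u ≡ v
  begins-unique (_ , refl) (_ , eq) = ∷-injectiveˡ eq

  begins⇒∈ : ∀ {w u} → Begins w u → u ∈ w
  begins⇒∈ (_ , refl) = here refl

  ends⇒∈ : ∀ {w u} → Ends w u → u ∈ w
  ends⇒∈ (xs , refl) = ∈-insert xs

  adjacent-++ˡ : ∀ {v u w} z → Adjacent v u w → Adjacent v u (w ++ z)
  adjacent-++ˡ z (xs , ys , refl) = xs , ys ++ z , ++-assoc xs _ z

  adjacent-++ʳ : ∀ {v u} z {w} → Adjacent v u w → Adjacent v u (z ++ w)
  adjacent-++ʳ z (xs , ys , refl) = z ++ xs , ys , sym (++-assoc z xs _)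

  adjacent-mid : ∀ {w z v u} → Ends w v → Begins z u → Adjacent v u (w ++ z)
  adjacent-mid (xs , refl) (ys , refl) = xs , ys , ++-assoc xs _ _

  adjacent-++⁻ : ∀ w z {v u} → Adjacent v u (w ++ z) →
    Adjacent v u w ⊎ (Ends w v × Begins z u) ⊎ Adjacent v u z
  adjacent-++⁻ []          z a                  = inj₂ (inj₂ a)
  adjacent-++⁻ (x ∷ [])    z ([] , ys , refl)   = inj₂ (inj₁ (([] , refl) , ys , refl))
  adjacent-++⁻ (x ∷ y ∷ w) z ([] , ys , refl)   = inj₁ ([] , w , refl)
  adjacent-++⁻ (x ∷ w)     z (_ ∷ xs , ys , eq)
    with refl , eq′ ← ∷-injective eq
    with adjacent-++⁻ w z (xs , ys , eq′)
  ... | inj₁ (as , bs , refl)       = inj₁ (x ∷ as , bs , refl)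
  ... | inj₂ (inj₁ ((as , refl) , b)) = inj₂ (inj₁ ((x ∷ as , refl) , b))
  ... | inj₂ (inj₂ a)               = inj₂ (inj₂ a)

  ∈⇒adjacent : ∀ z {w u} → u ∈ w → ∃ λ v → Adjacent v u (z ∷ w)
  ∈⇒adjacent z (here refl) = z , [] , _ , refl
  ∈⇒adjacent z {x ∷ w} (there i) with v , a ← ∈⇒adjacent x i = v , adjacent-++ʳ [ z ] a

  head∉tail : ∀ {x : X} {xs} → Unique (x ∷ xs) → x ∉ xs
  head∉tail (p ∷ _) i = All.lookup p i refl

  -- Without repetitions `x` has only one position, and both decompositions cut there.
  unique-split : ∀ {x} as {bs} cs {ds} → Unique (as ++ x ∷ bs) → as ++ x ∷ bs ≡ cs ++ x ∷ ds →
    as ≡ cs × bs ≡ ds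
  unique-split []       []       u eq = refl , ∷-injectiveʳ eq
  unique-split []       (c ∷ cs) u refl = contradiction (∈-insert cs) (head∉tail u)
  unique-split (a ∷ as) []       u refl = contradiction (∈-insert as) (head∉tail u)
  unique-split (a ∷ as) (c ∷ cs) (_ ∷ u) eq
    with refl , eq′ ← ∷-injective eq
    with refl , eq″ ← unique-split as cs u eq′ = refl , eq″

  unique-disjoint : ∀ as {bs x} → Unique (as ++ bs) → x ∈ as → x ∉ bs
  unique-disjoint (a ∷ as) u (here refl) j = head∉tail u (∈-++⁺ʳ as j)
  unique-disjoint (a ∷ as) (_ ∷ u) (there i) j = unique-disjoint as u i j

  unique-suffix : ∀ as {bs : List X} → Unique (as ++ bs) → Unique bs
  unique-suffix []       u       = u
  unique-suffix (a ∷ as) (_ ∷ u) = unique-suffix as u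

  predecessor-unique : ∀ {w v v′ u} → Unique w → Adjacent v u w → Adjacent v′ u w → v ≡ v′
  predecessor-unique {v = v} {v′} {u} uw (xs , ys , refl) (xs′ , ys′ , eq) =
    ∷ʳ-injectiveʳ xs xs′ (proj₁ (unique-split (xs ∷ʳ v) (xs′ ∷ʳ v′)
      (subst Unique (sym (++-assoc xs [ v ] _)) uw)
      (trans (++-assoc xs [ v ] _) (trans eq (sym (++-assoc xs′ [ v′ ] _))))))

  successor-unique : ∀ {w v u u′} → Unique w → Adjacent v u w → Adjacent v u′ w → u ≡ u′
  successor-unique uw (xs , ys , refl) (xs′ , ys′ , eq) =
    ∷-injectiveˡ (proj₂ (unique-split xs xs′ uw eq))

  first-has-no-predecessor : ∀ {w u v} → Unique w → Begins w u → ¬ Adjacent v u w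
  first-has-no-predecessor uw (_ , refl) ([]     , _ , eq) with refl ← ∷-injectiveˡ eq | refl ← ∷-injectiveʳ eq =
    head∉tail uw (here refl)
  first-has-no-predecessor uw (_ , refl) (x ∷ xs , _ , eq) with refl ← ∷-injectiveˡ eq | refl ← ∷-injectiveʳ eq =
    head∉tail uw (∈-++⁺ʳ xs (there (here refl)))

-- The cycle map under an exchange of two blocks.

-- Follow the dotted edge out of y and the black edge after it.
Step : List ℕ → ℕ → ℕ → Set
Step w y x = Adjacent x (suc y) w

-- A nonempty chain of `R`-steps from `y` to `x` whose intermediate points all lie in `S`. One step
-- after a move unfolds into such a chain of steps before it.
data Through (S : ℕ → Set) (R : ℕ → ℕ → Set) (y x : ℕ) : Set where
  direct : R y x → Through S R y x
  via    : ∀ {m} → S m → R y m → Through S R m x → Through S R y x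

-- The two occurrences of the pointer p are the boundaries between a and b and
-- between c and d.  One of them is its head pointer and the other its tail pointer.
Cut : ℕ → (a b c d : List ℕ) → Set
Cut p a b c d = Ends a p × Begins d (suc p) ⊎ Begins b (suc p) × Ends c p

module Exchange {p q} (a b c d e : List ℕ) (cutp : Cut p a b c d) (cutq : Cut q b c d e) where

  before after : List ℕ
  before = a ++ b ++ c ++ d ++ e
  after  = a ++ d ++ c ++ b ++ e

  Removed : ℕ → Set
  Removed m = m ≡ p ⊎ m ≡ q

  private
    in-ab : ∀ {v u} → Ends a v → Begins (b ++ c ++ d ++ e) u → Adjacent v u before
    in-ab = adjacent-mid
    in-bc : ∀ {v u} → Ends b v → Begins (c ++ d ++ e) u → Adjacent v u before
    in-bc x y = adjacent-++ʳ a (adjacent-mid x y)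
    in-cd : ∀ {v u} → Ends c v → Begins (d ++ e) u → Adjacent v u before
    in-cd x y = adjacent-++ʳ a (adjacent-++ʳ b (adjacent-mid x y))
    in-de : ∀ {v u} → Ends d v → Begins e u → Adjacent v u before
    in-de x y = adjacent-++ʳ a (adjacent-++ʳ b (adjacent-++ʳ c (adjacent-mid x y)))

    T = Through Removed (Step before)
    via-p : ∀ {y x} → Step before y p → T p x → T y x
    via-p = via (inj₁ refl)
    via-q : ∀ {y x} → Step before y q → T q x → T y x
    via-q = via (inj₂ refl)

    -- The entry y+1 begins a block, so the pointer occurring at that boundary is not its tail
    -- pointer, as y is not removed. It is therefore a head pointer, and its entry was the old left
    -- neighbour of y+1. From there the chain continues with the other occurrence of the same
    -- pointer. The lemmas for c, b and e argue in the same way.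
    step-d : ∀ {y x} → ¬ Removed y → Begins d (suc y) → Ends a x → Cut p a b c d → T y x
    step-d y∉ bd ea (inj₁ (_ , bp))  = contradiction (inj₁ (suc-injective (begins-unique bd bp))) y∉
    step-d y∉ bd ea (inj₂ (bp , ep)) = via-p (in-cd ep (begins-++ e bd)) (direct (in-ab ea (begins-++ _ bp)))

    step-c : ∀ {y x} → ¬ Removed y → Begins c (suc y) → Ends (a ++ d) x → Cut q b c d e → T y x
    step-c y∉ bc ead (inj₂ (bq , _))  = contradiction (inj₂ (suc-injective (begins-unique bc bq))) y∉
    step-c y∉ bc ead (inj₁ (eq , bq)) = via-q (in-bc eq (begins-++ _ bc)) (last (ends-++⁻ a d ead) cutp)
      where
      -- If d is empty, the old left neighbour of q+1 is the last entry of c. This is p, so the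
      -- chain passes both removed values.
      last : ∀ {x} → Ends d x ⊎ d ≡ [] × Ends a x → Cut p a b c d → T q x
      last (inj₁ ed)          _                = direct (in-de ed bq)
      last (inj₂ (refl , ea)) (inj₂ (bp , ep)) =
        via-p (in-cd ep bq) (direct (in-ab ea (begins-++ _ bp)))
      last (inj₂ (refl , ea)) (inj₁ (_ , _ , ()))

    step-b : ∀ {y x} → ¬ Removed y → Begins b (suc y) → Ends ((a ++ d) ++ c) x → Cut p a b c d → T y x
    step-b y∉ bb eadc (inj₂ (bp , _))  = contradiction (inj₁ (suc-injective (begins-unique bb bp))) y∉
    step-b y∉ bb eadc (inj₁ (ep , bp)) =
      via-p (in-ab ep (begins-++ _ bb)) (last (ends-++⁻ (a ++ d) c eadc) cutq)
      where
      last : ∀ {x} → Ends c x ⊎ c ≡ [] × Ends (a ++ d) x → Cut q b c d e → T p x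
      last (inj₁ ec)            _              = direct (in-cd ec (begins-++ e bp))
      last (inj₂ (refl , ead))  (inj₁ (eq , bq)) with ends-++⁻ a d ead
      ... | inj₁ ed          = via-q (in-bc eq (begins-++ e bp)) (direct (in-de ed bq))
      ... | inj₂ (refl , _)  with () ← proj₂ bp
      last (inj₂ (refl , _))    (inj₂ ((_ , ()) , _))

    step-e : ∀ {y x} → ¬ Removed y → Begins e (suc y) → Ends (((a ++ d) ++ c) ++ b) x →
      Cut q b c d e → T y x
    step-e y∉ be eadcb (inj₁ (_ , bq))  = contradiction (inj₂ (suc-injective (begins-unique be bq))) y∉
    step-e y∉ be eadcb (inj₂ (bq , eq)) =
      via-q (in-de eq be) (last (ends-++⁻ ((a ++ d) ++ c) b eadcb) cutp)
      where
      last : ∀ {x} → Ends b x ⊎ b ≡ [] × Ends ((a ++ d) ++ c) x → Cut p a b c d → T q x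
      last (inj₁ eb)             _             = direct (in-bc eb (begins-++ _ bq))
      last (inj₂ (refl , eadc))  (inj₁ (ep , bp)) with ends-++⁻ (a ++ d) c eadc
      ... | inj₁ ec          = via-p (in-ab ep (begins-++ _ bq)) (direct (in-cd ec (begins-++ e bp)))
      ... | inj₂ (refl , _)  with () ← proj₂ bq
      last (inj₂ (refl , _))     (inj₂ ((_ , ()) , _))

    reassoc : after ≡ ((((a ++ d) ++ c) ++ b) ++ e)
    reassoc = trans (sym (++-assoc a d _)) (trans (sym (++-assoc (a ++ d) c _)) (sym (++-assoc ((a ++ d) ++ c) b e)))

  -- An adjacency after the exchange either lies inside one block, where it existed before, or
  -- straddles one of the four new boundaries.
  lift : ∀ {y x} → ¬ Removed y → Step after y x → T y x
  -- Bracketing to the left keeps everything before a boundary together, so the left neighbour is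
  -- found even when the block just before is empty.
  lift y∉ s with adjacent-++⁻ (((a ++ d) ++ c) ++ b) e (subst (Adjacent _ _) reassoc s)
  ... | inj₂ (inj₁ (l , r)) = step-e y∉ r l cutq
  ... | inj₂ (inj₂ s)       = direct (adjacent-++ʳ a (adjacent-++ʳ b (adjacent-++ʳ c (adjacent-++ʳ d s))))
  ... | inj₁ s with adjacent-++⁻ ((a ++ d) ++ c) b s
  ... | inj₂ (inj₁ (l , r)) = step-b y∉ r l cutp
  ... | inj₂ (inj₂ s)       = direct (adjacent-++ʳ a (adjacent-++ˡ _ s))
  ... | inj₁ s with adjacent-++⁻ (a ++ d) c s
  ... | inj₂ (inj₁ (l , r)) = step-c y∉ r l cutq
  ... | inj₂ (inj₂ s)       = direct (adjacent-++ʳ a (adjacent-++ʳ b (adjacent-++ˡ _ s)))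
  ... | inj₁ s with adjacent-++⁻ a d s
  ... | inj₂ (inj₁ (l , r)) = step-d y∉ r l cutp
  ... | inj₂ (inj₂ s)       = direct (adjacent-++ʳ a (adjacent-++ʳ b (adjacent-++ʳ c (adjacent-++ˡ e s))))
  ... | inj₁ s              = direct (adjacent-++ˡ _ s)

  -- The exchange joins the two occurrences of each pointer: those of p meet at the boundary of a
  -- and d or of c and b, those of q at that of b and e or of d and c.
  removed-fixed : ∀ {m} → Removed m → Step after m m
  removed-fixed (inj₁ refl) = fixed cutp
    where
    fixed : Cut p a b c d → Step after p p
    fixed (inj₁ (l , r)) = adjacent-mid l (begins-++ _ r)
    fixed (inj₂ (r , l)) = adjacent-++ʳ a (adjacent-++ʳ d (adjacent-mid l (begins-++ _ r)))
  removed-fixed (inj₂ refl) = fixed cutq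
    where
    fixed : Cut q b c d e → Step after q q
    fixed (inj₁ (l , r)) = adjacent-++ʳ a (adjacent-++ʳ d (adjacent-++ʳ c (adjacent-mid l r)))
    fixed (inj₂ (r , l)) = adjacent-++ʳ a (adjacent-mid l (begins-++ _ r))

  -- If p comes first, an occurrence of q between those of p forces b or c to be nonempty, which
  -- separates p from p+1. If p+1 comes first, p stands to its right. Termination of the game rests
  -- on this: each move creates a new fixed point of the cycle map.
  moved : Unique before → ¬ Step before p p
  moved u s = [ head-first , tail-first ]′ cutp
    where
    u′ : Unique (b ++ c ++ d ++ e)
    u′ = unique-suffix a u

    head-first : ¬ (Ends a p × Begins d (suc p))
    head-first (ep , bp) = nonempty b refl cutq
      where
      next : ∀ {z} → Begins (b ++ c ++ d ++ e) z → z ≡ suc p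
      next bz = successor-unique u (in-ab ep bz) s

      nonempty : ∀ b′ → b ≡ b′ → ¬ Cut q b c d e
      nonempty (y ∷ b′) refl _ with refl ← next (_ , refl) =
        unique-disjoint b u′ (here refl) (∈-++⁺ʳ c (∈-++⁺ˡ (begins⇒∈ bp)))
      nonempty [] refl (inj₁ (l , _)) with () ← ends⇒∈ l
      nonempty [] refl (inj₂ (bq , _)) =
        unique-disjoint c u′ (subst (_∈ c) (next (begins-++ _ bq)) (begins⇒∈ bq))
          (∈-++⁺ˡ (begins⇒∈ bp))

    tail-first : ¬ (Begins b (suc p) × Ends c p)
    tail-first (bp , ep) with adjacent-++⁻ a _ s
    ... | inj₁ (xs , ys , eq)  = unique-disjoint a u (subst (p ∈_) (sym eq) (∈-insert xs)) p∈bcde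
      where p∈bcde = ∈-++⁺ʳ b (∈-++⁺ˡ (ends⇒∈ ep))
    ... | inj₂ (inj₁ (ea , _)) = unique-disjoint a u (ends⇒∈ ea) (∈-++⁺ʳ b (∈-++⁺ˡ (ends⇒∈ ep)))
    ... | inj₂ (inj₂ t)        = first-has-no-predecessor u′ (begins-++ _ bp) t

-- From pointer occurrences to cuts of the list of entries.

entries-++ : ∀ xs ys → entries (xs ++ ys) ≡ entries xs ++ entries ys
entries-++ []             ys = refl
entries-++ (ptr _   ∷ xs) ys = entries-++ xs ys
entries-++ (entry k ∷ xs) ys = cong (k ∷_) (entries-++ xs ys)

entries-marked : ∀ α → entries (marked α) ≡ α
entries-marked []      = refl
entries-marked (k ∷ α) = cong (k ∷_) (entries-marked α)

ends-entries : ∀ {w k} → Ends w (entry k) → Ends (entries w) k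
ends-entries (xs , refl) = entries xs , entries-++ xs _

begins-entries : ∀ {w k} → Begins w (entry k) → Begins (entries w) k
begins-entries (ys , refl) = entries ys , refl

-- The last token is an entry and so lies after `ptr q`. This confines the entry beside a pointer to
-- the block next to it.
ends-after-ptr : ∀ v {q w k} → Ends (v ++ ptr q ∷ w) (entry k) → Ends w (entry k)
ends-after-ptr v {w = w} e with ends-++⁻ v (ptr _ ∷ w) e
... | inj₁ ([] , ())
... | inj₁ (x ∷ xs , refl) = xs , refl

begins-before-ptr : ∀ w {q v k} → Begins (w ++ ptr q ∷ v) (entry k) → Begins w (entry k)
begins-before-ptr []      (_ , ())
begins-before-ptr (x ∷ w) (_ , refl) = w , refl

-- Entries have to be nonzero because `pred 0` is 0: the token in front of an entry 0 would be
-- `ptr 0` without being the tail pointer of 1.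
head-or-tail : ∀ α {p} → All NonZero α → ∀ xs {ys} → marked α ≡ xs ++ ptr p ∷ ys →
  Ends xs (entry p) ⊎ Begins ys (entry (suc p))
head-or-tail []          _         []      ()
head-or-tail []          _         (_ ∷ _) ()
head-or-tail (suc k ∷ α) _         []           refl = inj₂ (_ , refl)
head-or-tail (zero ∷ α)  (() ∷ _)  []           _
head-or-tail (k ∷ α)     _         (_ ∷ [])     ()
head-or-tail (k ∷ α)     _         (_ ∷ _ ∷ []) refl = inj₁ (_ ∷ [] , refl)
head-or-tail (k ∷ α)     (_ ∷ nz)  (x ∷ y ∷ z ∷ xs) eq =
  Sum.map₁ (ends-++ (x ∷ y ∷ z ∷ []))
    (head-or-tail α nz xs (∷-injectiveʳ (∷-injectiveʳ (∷-injectiveʳ eq))))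

-- Two head pointers would put p into both a and c, and two tail pointers would put p+1 into both b
-- and d.
cut-from-occurrences : ∀ {p a b c d} → (∀ {x} → x ∈ a → x ∉ c) → (∀ {x} → x ∈ b → x ∉ d) →
  Ends a p ⊎ Begins b (suc p) → Ends c p ⊎ Begins d (suc p) → Cut p a b c d
cut-from-occurrences ac bd (inj₁ x) (inj₁ y) = contradiction (ends⇒∈ y) (ac (ends⇒∈ x))
cut-from-occurrences ac bd (inj₁ x) (inj₂ y) = inj₁ (x , y)
cut-from-occurrences ac bd (inj₂ x) (inj₁ y) = inj₂ (x , y)
cut-from-occurrences ac bd (inj₂ x) (inj₂ y) = contradiction (begins⇒∈ y) (bd (begins⇒∈ x))

-- Permutations framed by 0 and n+1.

Frame : ℕ → List ℕ → List ℕ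
Frame n α = 0 ∷ α ++ [ suc n ]

module _ {n α} (perm : IsPermutation n α) where

  unique-permutation : Unique α
  unique-permutation = Permutation.Unique-resp-↭ (setoid ℕ) (↭⇒↭ₛ (↭-sym perm))
    (applyUpTo⁺₁ suc n λ i<j _ → <⇒≢ i<j ∘ suc-injective)

  unique-frame : Unique (Frame n α)
  unique-frame = Permutation.Unique-resp-↭ (setoid ℕ) (↭⇒↭ₛ (↭-sym frame↭)) (upTo⁺ (2 + n))
    where
    frame↭ : Frame n α ↭ upTo (2 + n)
    frame↭ = ↭-prep 0 (↭-trans (++⁺ʳ _ perm) (↭-reflexive (applyUpTo-∷ʳ suc n)))

  entry-bounds : ∀ {k} → k ∈ α → NonZero k × k ≤ n
  entry-bounds k∈α with i , i<n , refl ← ∈-applyUpTo⁻ suc (∈-resp-↭ perm k∈α) = _ , i<n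

  entries-nonZero : All NonZero α
  entries-nonZero = All.tabulate (proj₁ ∘ entry-bounds)

  suc∈ : ∀ {k} → k < n → suc k ∈ α
  suc∈ k<n = ∈-resp-↭ (↭-sym perm) (∈-applyUpTo⁺ suc k<n)

  step-total : ∀ {y} → y ≤ n → ∃ (Step (Frame n α) y)
  step-total y≤n with m≤n⇒m<n∨m≡n y≤n
  ... | inj₁ y<n  = ∈⇒adjacent 0 (∈-++⁺ˡ (suc∈ y<n))
  ... | inj₂ refl = ∈⇒adjacent 0 (∈-insert α)

-- The effect of a move on the alternating cycles.

OneOf : ℕ → ℕ → ℕ → Set
OneOf p q m = m ≡ p ⊎ m ≡ q

-- What a move does to the cycles, with the blocks forgotten: the points of `S` become fixed, the
-- cycles are short-circuited past them, and at least one of them was not fixed before.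
record Excision (n : ℕ) (α β : List ℕ) (S : ℕ → Set) : Set where
  field
    permutation : IsPermutation n β
    lift        : ∀ {y x} → ¬ S y → Step (Frame n β) y x → Through S (Step (Frame n α)) y x
    fixed       : ∀ {m} → S m → Step (Frame n β) m m
    moved       : ∃ λ m → S m × ¬ Step (Frame n α) m m

excision-resp : ∀ {n α β S T} → (∀ {m} → S m → T m) → (∀ {m} → T m → S m) →
  Excision n α β S → Excision n α β T
excision-resp {n} {α} {S = S} {T} to from x = record
  { permutation = permutation
  ; lift        = λ y∉ s → map-through (lift (y∉ ∘ to) s)
  ; fixed       = fixed ∘ from
  ; moved       = proj₁ moved , to (proj₁ (proj₂ moved)) , proj₂ (proj₂ moved)
  }
  where
  open Excision x
  map-through : ∀ {y x} → Through S (Step (Frame n α)) y x → Through T (Step (Frame n α)) y x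
  map-through (direct s)  = direct s
  map-through (via m s t) = via (to m) s (map-through t)

exchange-excises : ∀ {n α p q} → IsPermutation n α → (x : Alternation p q α) →
  Excision n α (exchange x) (OneOf p q)
exchange-excises {n} {α} {p} {q} perm (alternation A B C D E cut) = record
  { permutation = ↭-trans swapped (subst (_↭ identity n) α≡ perm)
  ; lift        = λ {y} {x} y∉ s → subst (λ w → Through (OneOf p q) (Step w) y x) (sym frame-α≡)
                                          (X.lift y∉ (subst (Adjacent _ _) frame-β≡ s))
  ; fixed       = λ m → subst (Adjacent _ _) (sym frame-β≡) (X.removed-fixed m)
  ; moved       = p , inj₁ refl , λ s →
      X.moved (subst Unique frame-α≡ (unique-frame perm)) (subst (Adjacent _ _) frame-α≡ s)
  }
  where
  a = entries A
  b = entries B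
  c = entries C
  d = entries D
  e = entries E

  α≡ : α ≡ a ++ b ++ c ++ d ++ e
  α≡ = trans (sym (entries-marked α)) (trans (cong entries cut)
    (trans (entries-++ A _) (cong (a ++_) (trans (entries-++ B _) (cong (b ++_)
      (trans (entries-++ C _) (cong (c ++_) (entries-++ D _))))))))

  reframe : ∀ (a b c d e : List ℕ) → Frame n (a ++ b ++ c ++ d ++ e) ≡ (0 ∷ a) ++ b ++ c ++ d ++ e ++ [ suc n ]
  reframe a b c d e = cong (0 ∷_) (trans (++-assoc a _ _) (cong (a ++_) (trans (++-assoc b _ _)
    (cong (b ++_) (trans (++-assoc c _ _) (cong (c ++_) (++-assoc d e _)))))))

  frame-α≡ = trans (cong (Frame n) α≡) (reframe a b c d e)
  frame-β≡ = reframe a d c b e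

  swapped : a ++ d ++ c ++ b ++ e ↭ a ++ b ++ c ++ d ++ e
  swapped = ++⁺ˡ a (↭-trans (++⁺ˡ d (shifts c b)) (↭-trans (shifts d b) (++⁺ˡ b (shifts d c))))

  AB  = A ++ ptr p ∷ B
  ABC = AB ++ ptr q ∷ C

  cut₂ : marked α ≡ AB ++ ptr q ∷ C ++ ptr p ∷ D ++ ptr q ∷ E
  cut₂ = trans cut (sym (++-assoc A (ptr p ∷ B) _))

  cut₃ : marked α ≡ ABC ++ ptr p ∷ D ++ ptr q ∷ E
  cut₃ = trans cut₂ (sym (++-assoc AB (ptr q ∷ C) _))

  cut₄ : marked α ≡ (ABC ++ ptr p ∷ D) ++ ptr q ∷ E
  cut₄ = trans cut₃ (sym (++-assoc ABC (ptr p ∷ D) _))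

  occurrence : ∀ xs {k ys} → marked α ≡ xs ++ ptr k ∷ ys → Ends xs (entry k) ⊎ Begins ys (entry (suc k))
  occurrence xs = head-or-tail α (entries-nonZero perm) xs

  unique-abcde : Unique (a ++ b ++ c ++ d ++ e)
  unique-abcde = subst Unique α≡ (unique-permutation perm)

  unique-bcde : Unique (b ++ c ++ d ++ e)
  unique-bcde = unique-suffix a unique-abcde

  cut-p : Cut p a b c d
  cut-p = cut-from-occurrences
    (λ i j → unique-disjoint a unique-abcde i (∈-++⁺ʳ b (∈-++⁺ˡ j)))
    (λ i j → unique-disjoint b unique-bcde i (∈-++⁺ʳ c (∈-++⁺ˡ j)))
    (Sum.map ends-entries (begins-entries ∘ begins-before-ptr B) (occurrence A cut))
    (Sum.map (ends-entries ∘ ends-after-ptr AB) (begins-entries ∘ begins-before-ptr D)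
      (occurrence ABC cut₃))

  cut-q : Cut q b c d e
  cut-q = cut-from-occurrences
    (λ i j → unique-disjoint b unique-bcde i (∈-++⁺ʳ c (∈-++⁺ˡ j)))
    (λ i j → unique-disjoint c (unique-suffix b unique-bcde) i (∈-++⁺ʳ d j))
    (Sum.map (ends-entries ∘ ends-after-ptr A) (begins-entries ∘ begins-before-ptr C)
      (occurrence AB cut₂))
    (Sum.map (ends-entries ∘ ends-after-ptr ABC) begins-entries
      (occurrence (ABC ++ ptr p ∷ D) cut₄))

  -- The entries 0 and n+1 join the outer blocks, which stay in place, so that the exchange acts on
  -- the whole frame.
  module X = Exchange {p} {q} (0 ∷ a) b c d (e ++ [ suc n ])
    (Sum.map₁ (λ (l , r) → ends-++ [ 0 ] l , r) cut-p)
    (Sum.map₁ (λ (l , r) → l , begins-++ [ suc n ] r) cut-q)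

interlock-excises : ∀ {n m α} {p q : Fin m} → IsPermutation n α → (x : Interlock p q α) →
  Excision n α (cds p q x) (OneOf (label p) (label q))
interlock-excises perm (_ , inj₁ x) = exchange-excises perm x
interlock-excises perm (_ , inj₂ x) = excision-resp swap swap (exchange-excises perm x)

-- Alternating paths before and after a move.

module _ {n α} (perm : IsPermutation n α) where
  open CycleGraph n α

  path-from : ∀ {k es m} → Path k es → m ∈ es → ∃ (Path m)
  path-from stop             (here refl) = _ , stop
  path-from π@(step _ _ _ _) (here refl) = _ , π
  path-from (step _ _ _ π)   (there m∈)  = path-from π m∈

  -- From a nonzero fixed point every step leads back to it, so the path would never reach 0.
  no-path-from-fixed : ∀ {m es} → m ≢ 0 → Step (Frame n α) m m → ¬ Path m es
  no-path-from-fixed m≢0 s stop = m≢0 refl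
  no-path-from-fixed m≢0 s (step _ (_ , refl) blk π)
    with refl ← predecessor-unique (unique-frame perm) s blk = no-path-from-fixed m≢0 s π

  fixed∉path : ∀ {m k es} → m ≢ 0 → Step (Frame n α) m m → Path k es → m ∉ es
  fixed∉path m≢0 s π m∈ = no-path-from-fixed m≢0 s (proj₂ (path-from π m∈))

  -- The points of `S` are nonzero, so no path stops inside the chain that is put in front.
  path-extend : ∀ {S : ℕ → Set} → (∀ {m} → S m → m ≢ 0 × m ≤ n) → ∀ {y x es} → y ≢ 0 → y ≤ n →
    Through S (Step (Frame n α)) y x → Path x es → ∃ λ fs → Path y (y ∷ fs) × (∀ {r} → r ∈ es → r ∈ fs)
  path-extend bnd y≢0 y≤n (direct s)    π = _ , step y≢0 (y≤n , refl) s π , λ i → i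
  path-extend bnd y≢0 y≤n (via Sm s t) π
    with fs , π′ , sub ← path-extend bnd (proj₁ (bnd Sm)) (proj₂ (bnd Sm)) t π
    = _ , step y≢0 (y≤n , refl) s π′ , there ∘ sub

module Transfer {n α β S} (perm : IsPermutation n α) (x : Excision n α β S)
  (bounds : ∀ {m} → S m → m ≢ 0 × m ≤ n) where

  open Excision x
  module P = CycleGraph n α
  module Q = CycleGraph n β

  -- The cycle map of β is injective and fixes `S` pointwise, so it sends nothing from outside into
  -- `S`.
  target∉S : ∀ {y z} → ¬ S y → Step (Frame n β) y z → ¬ S z
  target∉S y∉ s Sz with refl ← successor-unique (unique-frame permutation) s (fixed Sz) = y∉ Sz

  -- The first step of the lifted chain has to be the loop at m; as m is not in `S`, the chain ends
  -- there.
  fixed-preserved : ∀ {m} → m ≤ n → ¬ S m → Step (Frame n α) m m → Step (Frame n β) m m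
  fixed-preserved m≤n m∉ s with z , t ← step-total permutation m≤n with lift m∉ t
  ... | direct s′ with refl ← predecessor-unique (unique-frame perm) s s′ = t
  ... | via Sm s′ _ with refl ← predecessor-unique (unique-frame perm) s s′ = contradiction Sm m∉

  -- Each step of the new path is replaced by the chain that `lift` provides, so the old path
  -- contains the new one.
  pull : ∀ {k es} → ¬ S k → Q.Path k es → ∃ λ fs → P.Path k fs × (∀ {r} → r ∈ es → r ∈ fs)
  pull k∉ Q.stop = _ , P.stop , λ i → i
  pull k∉ (Q.step k≢0 (k≤n , refl) s π)
    with fs , π′ , sub ← pull (target∉S k∉ s) π
    with gs , π″ , sub′ ← path-extend perm bounds k≢0 k≤n (lift k∉ s) π′
    = _ , π″ , λ where (here refl) → here refl
                       (there i)   → there (sub′ (sub i))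

  mutual
    -- Left neighbours are unique, so the old path runs along the lifted chains. Its points in `S`
    -- are skipped and all others survive.
    push : ∀ {k es} → ¬ S k → P.Path k es → ∃ λ fs → Q.Path k fs × (∀ {r} → ¬ S r → r ∈ es → r ∈ fs)
    push k∉ P.stop = _ , Q.stop , λ _ i → i
    push k∉ (P.step k≢0 (k≤n , refl) s π)
      with z , t ← step-total permutation k≤n
      with fs , π′ , sub ← push-step (target∉S k∉ t) (lift k∉ t) s π
      = _ , Q.step k≢0 (k≤n , refl) t π′ , λ where _  (here refl) → here refl
                                                   r∉ (there i)   → there (sub r∉ i)

    push-step : ∀ {k j x es} → ¬ S x → Through S (Step (Frame n α)) k x → Step (Frame n α) k j →
      P.Path j es → ∃ λ fs → Q.Path x fs × (∀ {r} → ¬ S r → r ∈ es → r ∈ fs)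
    push-step x∉ (direct t)    s π with refl ← predecessor-unique (unique-frame perm) s t = push x∉ π
    push-step x∉ (via Sm t ts) s π with refl ← predecessor-unique (unique-frame perm) s t = push-via x∉ Sm ts π

    push-via : ∀ {m x es} → ¬ S x → S m → Through S (Step (Frame n α)) m x →
      P.Path m es → ∃ λ fs → Q.Path x fs × (∀ {r} → ¬ S r → r ∈ es → r ∈ fs)
    push-via x∉ Sm t P.stop = contradiction refl (proj₁ (bounds Sm))
    push-via x∉ Sm t (P.step _ (_ , refl) s π)
      with fs , π′ , sub ← push-step x∉ t s π
      = _ , π′ , λ where r∉ (here refl) → contradiction Sm r∉
                         r∉ (there i)   → sub r∉ i

-- Decidability of interlocking.

_≟ᵗ_ : DecidableEquality Token
ptr i   ≟ᵗ ptr j   = map′ (cong ptr) (λ { refl → refl }) (i ℕ.≟ j)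
ptr i   ≟ᵗ entry j = no λ ()
entry i ≟ᵗ ptr j   = no λ ()
entry i ≟ᵗ entry j = map′ (cong entry) (λ { refl → refl }) (i ℕ.≟ j)

open DecSublist _≟ᵗ_ using (_⊆?_)

split-sublist : ∀ {X : Set} {x : X} {xs ts} → x ∷ xs Sublist.⊆ ts → ∃₂ λ as bs → ts ≡ as ++ x ∷ bs × xs Sublist.⊆ bs
split-sublist (y Sublist.∷ʳ s) with as , bs , refl , s′ ← split-sublist s = y ∷ as , bs , refl , s′
split-sublist (refl Sublist.∷ s) = [] , _ , refl , s

-- An alternation is an embedding of the word p q p q as a sublist of the tokens, and the sublist
-- relation is decidable.
alternation? : ∀ p q α → Dec (Alternation p q α)
alternation? p q α = map′ to from (ptr p ∷ ptr q ∷ ptr p ∷ ptr q ∷ [] ⊆? marked α)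
  where
  to : ptr p ∷ ptr q ∷ ptr p ∷ ptr q ∷ [] Sublist.⊆ marked α → Alternation p q α
  to s
    with A , _ , eqA , s₁ ← split-sublist s
    with B , _ , refl , s₂ ← split-sublist s₁
    with C , _ , refl , s₃ ← split-sublist s₂
    with D , E , refl , _ ← split-sublist s₃ = alternation A B C D E eqA

  from : Alternation p q α → ptr p ∷ ptr q ∷ ptr p ∷ ptr q ∷ [] Sublist.⊆ marked α
  from (alternation A B C D E cut) = subst (_ Sublist.⊆_) (sym cut)
    (⊆-++⁺ˡ A (refl Sublist.∷ ⊆-++⁺ˡ B (refl Sublist.∷ ⊆-++⁺ˡ C (refl Sublist.∷ ⊆-++⁺ˡ D (refl Sublist.∷ Sublist.minimum E)))))

interlock? : ∀ {m} (p q : Fin m) α → Dec (Interlock p q α)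
interlock? p q α = ¬? (p Fin.≟ q) ×-dec
  (alternation? (label p) (label q) α ⊎-dec alternation? (label q) (label p) α)

-- Pointers that interlock with no other pointer.

-- From a member of X one reaches i or i+1 by steps of ±1 without leaving X.
separated⇒empty : ∀ {n i} (X Y : List ℕ) → 1 ≤ i → i < n → i ∉ X → suc i ∉ X →
  (∀ {k} → 1 ≤ k → k ≤ n → k ∈ X ⊎ k ∈ Y) →
  (∀ {j} → 1 ≤ j → j < n → j ≢ i → j ∈ X ⊎ suc j ∈ X → j ∈ Y ⊎ suc j ∈ Y → ⊥) →
  ∀ {k} → 1 ≤ k → k ≤ n → k ∉ X
separated⇒empty {n} {i} X Y 1≤i i<n i∉ si∉ cover apart {k} 1≤k k≤n with k ≤? i
... | yes k≤i = below (i ∸ k) (m+[n∸m]≡n k≤i) 1≤k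
  where
  below : ∀ d {k} → k + d ≡ i → 1 ≤ k → k ∉ X
  below zero    {k} eq 1≤k k∈ = i∉ (subst (_∈ X) (trans (sym (+-identityʳ k)) eq) k∈)
  below (suc d) {k} eq 1≤k k∈ with cover (s≤s z≤n) k<n
    where
    k<n : k < n
    k<n = ≤-<-trans (m+n≤o⇒m≤o k (≤-reflexive eq)) i<n
  ... | inj₁ sk∈ = below d (trans (sym (+-suc k d)) eq) (s≤s z≤n) sk∈
  ... | inj₂ sk∈ = apart 1≤k (≤-<-trans (m+n≤o⇒m≤o k (≤-reflexive eq)) i<n)
                     (λ k≡i → i∉ (subst (_∈ X) k≡i k∈)) (inj₁ k∈) (inj₂ sk∈)
... | no k≰i = subst (_∉ X) (m∸n+n≡m (≰⇒> k≰i))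
                 (above (k ∸ suc i) (≤-trans (≤-reflexive (m∸n+n≡m (≰⇒> k≰i))) k≤n))
  where
  above : ∀ d → d + suc i ≤ n → d + suc i ∉ X
  above zero    _ si∈ = si∉ si∈
  above (suc d) d+i<n k∈ with cover (m≤n⇒m≤o+n d (s≤s z≤n)) (<⇒≤ d+i<n)
  ... | inj₁ j∈ = above d (<⇒≤ d+i<n) j∈
  ... | inj₂ j∈ = apart (m≤n⇒m≤o+n d (s≤s z≤n)) d+i<n (<⇒≢ (m≤n+m (suc i) d) ∘ sym) (inj₂ k∈) (inj₁ j∈)

-- The fixed points of cds with code (i,i+1) are of this form.
Wrapped : ℕ → List ℕ → Set
Wrapped i α = ∃ λ T → α ≡ (suc i ∷ T) ∷ʳ i

marked-++ : ∀ xs ys → marked (xs ++ ys) ≡ marked xs ++ marked ys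
marked-++ = concatMap-++ _

touches⇒ptr∈ : ∀ {X j} → j ∈ X ⊎ suc j ∈ X → ptr j ∈ marked X
touches⇒ptr∈ (inj₁ (here refl)) = there (there (here refl))
touches⇒ptr∈ (inj₁ (there i))   = there (there (there (touches⇒ptr∈ (inj₁ i))))
touches⇒ptr∈ (inj₂ (here refl)) = here refl
touches⇒ptr∈ (inj₂ (there i))   = there (there (there (touches⇒ptr∈ (inj₂ i))))

NonInterlocking : ℕ → ℕ → List ℕ → Set
NonInterlocking n i α = ∀ {j} → 1 ≤ j → j < n → j ≢ i → ¬ Alternation i j α × ¬ Alternation j i α

label<n : ∀ {n} (p : Pointer n) → label p < n
label<n {suc n} p = s≤s (toℕ<n p)

pointer : ∀ {n j} → 1 ≤ j → j < n → ∃ λ (p : Pointer n) → label p ≡ j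
pointer {suc n} {suc j} _ (s≤s j<n) = fromℕ< j<n , cong suc (toℕ-fromℕ< j<n)

nonInterlocking : ∀ {n α} {p : Pointer n} → (∀ q → ¬ Interlock p q α) → NonInterlocking n (label p) α
nonInterlocking {p = p} none 1≤j j<n j≢p with q , refl ← pointer 1≤j j<n =
  (λ x → none q (p≢q , inj₁ x)) , (λ x → none q (p≢q , inj₂ x))
  where
  p≢q = λ p≡q → j≢p (cong label (sym p≡q))

-- An occurrence of j between those of i together with one outside is an alternation: i j i j if the
-- outer one is on the right, j i j i if it is on the left.
no-straddle : ∀ {n i α L M N} → NonInterlocking n i α → marked α ≡ L ++ ptr i ∷ M ++ ptr i ∷ N →
  ∀ {j} → 1 ≤ j → j < n → j ≢ i → ptr j ∈ M → ptr j ∈ L ++ N → ⊥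
no-straddle {L = L} {N = N} none cut 1≤j j<n j≢i j∈M j∈LN
  with B , C , refl ← ∈-∃++ j∈M
  with ∈-++⁻ L j∈LN
... | inj₂ j∈N with D , E , refl ← ∈-∃++ j∈N =
  proj₁ (none 1≤j j<n j≢i) (alternation L B C D E (trans cut (cong (λ x → L ++ ptr _ ∷ x) (++-assoc B _ _))))
... | inj₁ j∈L with A , A′ , refl ← ∈-∃++ j∈L =
  proj₂ (none 1≤j j<n j≢i) (alternation A A′ B C N
    (trans cut (trans (++-assoc A _ _) (cong (λ x → A ++ ptr _ ∷ A′ ++ ptr _ ∷ x) (++-assoc B _ _)))))

module _ {n α i} (perm : IsPermutation n α) (1≤i : 1 ≤ i) (i<n : i < n) (none : NonInterlocking n i α) where

  private
    ∈-swap : ∀ (a b c : List ℕ) {k} → k ∈ a ++ b ++ c → k ∈ b ⊎ k ∈ a ++ c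
    ∈-swap a b c k∈ with ∈-++⁻ a k∈
    ... | inj₁ k∈a = inj₂ (∈-++⁺ˡ k∈a)
    ... | inj₂ k∈bc with ∈-++⁻ b k∈bc
    ... | inj₁ k∈b = inj₁ k∈b
    ... | inj₂ k∈c = inj₂ (∈-++⁺ʳ a k∈c)

    cover : ∀ {k} → 1 ≤ k → k ≤ n → k ∈ α
    cover {suc k} _ k<n = suc∈ perm k<n

    touches-++ : ∀ a {b j} → j ∈ a ++ b ⊎ suc j ∈ a ++ b → ptr j ∈ marked a ++ marked b
    touches-++ a t = subst (_ ∈_) (marked-++ a _) (touches⇒ptr∈ t)

    strip : ∀ {j} → j ≢ i → ∀ L N → ptr j ∈ L ++ ptr i ∷ N → ptr j ∈ L ++ N
    strip j≢i L N j∈ with ∈-++⁻ L j∈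
    ... | inj₁ j∈L          = ∈-++⁺ˡ j∈L
    ... | inj₂ (here refl)  = contradiction refl j≢i
    ... | inj₂ (there j∈N)  = ∈-++⁺ʳ L j∈N

    empty : ∀ {X} → (∀ {k} → k ∈ X → k ∈ α) → (∀ {k} → 1 ≤ k → k ≤ n → k ∉ X) → X ≡ []
    empty {[]}    _   _ = refl
    empty {x ∷ X} sub e with entry-bounds perm (sub (here refl))
    ... | nz , x≤n = contradiction (here refl) (e (>-nonZero⁻¹ _ {{nz}}) x≤n)

  -- Entries of `S` touch only pointers between the two occurrences of i; the other entries touch,
  -- apart from i itself, only pointers outside. Neither i nor i+1 is in `S`, so `separated⇒empty`
  -- makes `S` empty.
  head-before-tail : ∀ a S e → α ≡ a ++ i ∷ S ++ suc i ∷ e → Adjacent i (suc i) α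
  head-before-tail a S e refl = a , e , cong (λ S → a ++ i ∷ S ++ suc i ∷ e) S≡[]
    where
    L = marked a ++ ptr (pred i) ∷ entry i ∷ []
    M = marked S
    N = entry (suc i) ∷ ptr (suc i) ∷ marked e

    u : Unique (a ++ i ∷ S ++ suc i ∷ e)
    u = unique-permutation perm

    cut : marked α ≡ L ++ ptr i ∷ M ++ ptr i ∷ N
    cut = trans (marked-++ a _) (trans (cong (λ x → marked a ++ _ ∷ _ ∷ _ ∷ x) (marked-++ S _)) (sym (++-assoc (marked a) _ _)))

    marked-a∷ʳi : marked (a ∷ʳ i) ≡ L ++ [ ptr i ]
    marked-a∷ʳi = trans (marked-++ a _) (sym (++-assoc (marked a) _ _))

    ptr-outside : ∀ {j} → j ≢ i → ptr j ∈ marked (a ∷ʳ i) ++ ptr i ∷ N → ptr j ∈ L ++ N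
    ptr-outside j≢i j∈ = strip j≢i L N (subst (_ ∈_) (++-assoc L _ _)
      (strip j≢i (L ++ [ ptr i ]) N (subst (λ x → _ ∈ x ++ ptr i ∷ N) marked-a∷ʳi j∈)))

    S⊆α : ∀ {k} → k ∈ S → k ∈ α
    S⊆α = ∈-++⁺ʳ a ∘ there ∘ ∈-++⁺ˡ

    S≡[] : S ≡ []
    S≡[] = empty S⊆α (separated⇒empty S (a ∷ʳ i ++ suc i ∷ e) 1≤i i<n
      (λ i∈ → head∉tail (unique-suffix a u) (∈-++⁺ˡ i∈))
      (λ si∈ → unique-disjoint S (unique-suffix [ i ] (unique-suffix a u)) si∈ (here refl))
      (λ 1≤k k≤n → ∈-swap (a ∷ʳ i) S _ (subst (_ ∈_) (sym (++-assoc a [ i ] _)) (cover 1≤k k≤n)))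
      (λ 1≤j j<n j≢i tS tY → no-straddle none cut 1≤j j<n j≢i (touches⇒ptr∈ tS)
        (ptr-outside j≢i (touches-++ (a ∷ʳ i) tY))))

  -- Now i and i+1 both lie in the middle segment, so the set shown to be empty is the outer part
  -- `a ++ e`.
  tail-before-head : ∀ a T e → α ≡ a ++ ((suc i ∷ T) ∷ʳ i) ++ e → Wrapped i α
  tail-before-head a T e refl = T ,
    trans (cong₂ (λ a e → a ++ mid ++ e) (++-conicalˡ a e outer≡[]) (++-conicalʳ a e outer≡[]))
      (++-identityʳ mid)
    where
    mid = (suc i ∷ T) ∷ʳ i
    M = entry (suc i) ∷ ptr (suc i) ∷ marked T ++ ptr (pred i) ∷ entry i ∷ []

    u : Unique (a ++ mid ++ e)
    u = unique-permutation perm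

    marked-mid : marked mid ≡ ptr i ∷ M ++ [ ptr i ]
    marked-mid = cong (λ x → _ ∷ _ ∷ _ ∷ x) (trans (marked-++ T _) (sym (++-assoc (marked T) _ _)))

    cut : marked α ≡ marked a ++ ptr i ∷ M ++ ptr i ∷ marked e
    cut = trans (marked-++ a _) (cong (marked a ++_) (trans (marked-++ mid e)
      (trans (cong (_++ marked e) marked-mid) (cong (ptr i ∷_) (++-assoc M _ _)))))

    ptr-inside : ∀ {j} → j ≢ i → ptr j ∈ marked mid → ptr j ∈ M
    ptr-inside {j} j≢i j∈ = subst (ptr j ∈_) (++-identityʳ M)
      (strip j≢i M [] (strip j≢i [] (M ++ [ ptr i ]) (subst (ptr j ∈_) marked-mid j∈)))

    mid∉outer : ∀ {k} → k ∈ mid → k ∉ a ++ e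
    mid∉outer k∈mid k∈ with ∈-++⁻ a k∈
    ... | inj₁ k∈a = unique-disjoint a u k∈a (∈-++⁺ˡ k∈mid)
    ... | inj₂ k∈e = unique-disjoint mid (unique-suffix a u) k∈mid k∈e

    outer⊆α : ∀ {k} → k ∈ a ++ e → k ∈ α
    outer⊆α k∈ with ∈-++⁻ a k∈
    ... | inj₁ k∈a = ∈-++⁺ˡ k∈a
    ... | inj₂ k∈e = ∈-++⁺ʳ a (∈-++⁺ʳ mid k∈e)

    outer≡[] : a ++ e ≡ []
    outer≡[] = empty outer⊆α (separated⇒empty (a ++ e) mid 1≤i i<n
      (mid∉outer (∈-insert (suc i ∷ T))) (mid∉outer (here refl))
      (λ 1≤k k≤n → swap (∈-swap a mid e (cover 1≤k k≤n)))
      (λ 1≤j j<n j≢i tX tY → no-straddle none cut 1≤j j<n j≢i (ptr-inside j≢i (touches⇒ptr∈ tY))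
        (touches-++ a tX)))

  -- The order in which i and i+1 stand in α decides which alternative holds.
  isolated : Adjacent i (suc i) α ⊎ Wrapped i α
  isolated with a , b , eq ← ∈-∃++ (cover 1≤i (<⇒≤ i<n))
    with ∈-++⁻ a (subst (suc i ∈_) eq (cover (s≤s z≤n) i<n))
  ... | inj₂ (here si≡i) = contradiction si≡i 1+n≢n
  ... | inj₂ (there si∈b) with S , e , refl ← ∈-∃++ si∈b = inj₁ (head-before-tail a S e eq)
  ... | inj₁ si∈a with c , T , refl ← ∈-∃++ si∈a =
    inj₂ (tail-before-head c T b (trans eq (trans (++-assoc c _ _) (cong (c ++_) (cong (suc i ∷_) (sym (++-assoc T _ _)))))))

-- The form of the fixed points and their codes.

applyUpTo-cong : ∀ {X : Set} {f g : ℕ → X} → (∀ k → f k ≡ g k) → ∀ n → applyUpTo f n ≡ applyUpTo g n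
applyUpTo-cong f≗g zero    = refl
applyUpTo-cong f≗g (suc n) = cong₂ _∷_ (f≗g 0) (applyUpTo-cong (f≗g ∘ suc) n)

-- Each adjacency gives a decomposition at j of its own; by `unique-split` it agrees with the
-- position already reached, and the run grows by one entry.
run : ∀ {α} → Unique α → ∀ k {m} xs {ys} → α ≡ xs ++ m ∷ ys →
  (∀ {j} → m ≤ j → j < m + k → Adjacent j (suc j) α) →
  ∃ λ zs → α ≡ xs ++ applyUpTo (λ i → m + i) (suc k) ++ zs
run u zero {m} xs eq adj = _ , trans eq (cong (λ m → xs ++ m ∷ _) (sym (+-identityʳ m)))
run {α} u (suc k) {m} xs {ys} eq adj
  with as , bs , eq′ ← adj ≤-refl (m<m+n m (s≤s z≤n))
  with refl , refl ← unique-split xs as (subst Unique eq u) (trans (sym eq) eq′)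
  with zs , eq″ ← run u k (xs ∷ʳ m) (trans eq (sym (++-assoc xs _ _)))
         (λ {j} m<j j<m+k → adj (<⇒≤ m<j) (subst (j <_) (sym (+-suc m k)) j<m+k))
  = zs , trans eq″ (trans (++-assoc xs _ _) (cong₂ (λ h t → xs ++ h ∷ t ++ zs) (sym (+-identityʳ m))
      (applyUpTo-cong (λ i → sym (+-suc m i)) (suc k))))

∀⊎∃ : ∀ {m} {A B : Fin m → Set} → (∀ p → A p ⊎ B p) → (∀ p → A p) ⊎ ∃ B
∀⊎∃ {zero}  f = inj₁ λ ()
∀⊎∃ {suc m} f with f zero | ∀⊎∃ (f ∘ suc)
... | inj₂ b | _            = inj₂ (zero , b)
... | inj₁ a | inj₂ (p , b) = inj₂ (suc p , b)
... | inj₁ a | inj₁ as      = inj₁ λ where zero    → a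
                                           (suc p) → as p

length≡0 : ∀ {X : Set} {xs : List X} → length xs ≡ 0 → xs ≡ []
length≡0 {xs = []} _ = refl

++-injective : ∀ {X : Set} (xs ys : List X) {as bs} → length xs ≡ length ys →
  xs ++ as ≡ ys ++ bs → xs ≡ ys × as ≡ bs
++-injective []       []       _ eq = refl , eq
++-injective (x ∷ xs) (y ∷ ys) l eq with refl , eq′ ← ∷-injective eq
  with refl , eq″ ← ++-injective xs ys (suc-injective l) eq′ = refl , eq″

permutation-length : ∀ {n α} → IsPermutation n α → length α ≡ n
permutation-length {n} perm = trans (↭-length perm) (length-applyUpTo suc n)

-- The run that starts at 1 already has n entries, so by length nothing stands before or after it.
all-adjacent⇒identity : ∀ {n α} → IsPermutation n α →
  (∀ {j} → 1 ≤ j → j < n → Adjacent j (suc j) α) → α ≡ identity n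
all-adjacent⇒identity {zero} perm adj = ↭-empty-inv perm
all-adjacent⇒identity {suc n} perm adj
  with xs , _ , eq ← ∈-∃++ (suc∈ perm (s≤s z≤n))
  with zs , eq′ ← run (unique-permutation perm) n xs eq adj
  with lengths ← trans (sym (trans (length-++ xs) (cong (length xs +_) (length-++ (identity (suc n))))))
                       (trans (cong length (sym eq′)) (permutation-length perm))
  = trans eq′ (trans (cong₂ (λ xs zs → xs ++ identity (suc n) ++ zs) (proj₁ (both xs zs lengths)) (proj₂ (both xs zs lengths)))
      (++-identityʳ _))
  where
  both : ∀ xs zs → length xs + (length (identity (suc n)) + length zs) ≡ suc n → xs ≡ [] × zs ≡ []
  both xs zs eq = length≡0 (m+n≡0⇒m≡0 (length xs) sum≡0) , length≡0 (m+n≡0⇒n≡0 (length xs) sum≡0)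
    where
    open ≡-Reasoning
    sum≡0 : length xs + length zs ≡ 0
    sum≡0 = +-cancelˡ-≡ (suc n) _ _ (begin
      suc n + (length xs + length zs)                        ≡⟨ sym (+-assoc (suc n) (length xs) _) ⟩
      suc n + length xs + length zs                          ≡⟨ cong (_+ length zs) (+-comm (suc n) (length xs)) ⟩
      length xs + suc n + length zs                          ≡⟨ +-assoc (length xs) (suc n) _ ⟩
      length xs + (suc n + length zs)
        ≡⟨ cong (λ k → length xs + (k + length zs)) (sym (length-applyUpTo suc (suc n))) ⟩
      length xs + (length (identity (suc n)) + length zs)    ≡⟨ eq ⟩
      suc n                                                  ≡⟨ sym (+-identityʳ (suc n)) ⟩
      suc n + 0                                              ∎)

-- There are two runs: c+1,...,n from the front, and 1,...,c from the position of 1. As c is the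
-- last entry, the second run ends the list; what precedes it has length n-c and is therefore the
-- first run.
wrapped⇒code : ∀ {n α} → IsPermutation n α → (p : Pointer n) → Wrapped (label p) α →
  (∀ {j} → 1 ≤ j → j < n → j ≢ label p → Adjacent j (suc j) α) → HasCode n α p
wrapped⇒code {n} {α} perm p (T , wrap) adj
  with xs , _ , eq ← ∈-∃++ (suc∈ perm (≤-trans (s≤s z≤n) (label<n p)))
  -- `run` counts steps, not entries: `toℕ p` is c-1 for the c entries up to c, and `n ∸ suc c`
  -- serves the n-c entries above c.
  = glue (run u (toℕ p) xs eq λ 1≤j j<c → adj 1≤j (<-trans j<c c<n) (<⇒≢ j<c))
         (run u (n ∸ suc c) [] wrap λ c<j j<n →
           adj (≤-trans (s≤s z≤n) c<j) (subst (_ <_) (m+[n∸m]≡n c<n) j<n) (<⇒≢ c<j ∘ sym))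
  where
  u = unique-permutation perm
  c = label p
  c<n : c < n
  c<n = label<n p
  upper = applyUpTo (λ k → suc (c + k))

  glue : (∃ λ zs → α ≡ xs ++ identity c ++ zs) → (∃ λ ys → α ≡ upper (suc (n ∸ suc c)) ++ ys) →
    α ≡ upper (n ∸ c) ++ identity c
  glue (zs , eq₁) (ys , eq₂) = subst (λ xs → α ≡ xs ++ identity c) xs≡upper α≡xs++
    where
    open ≡-Reasoning
    zs≡[] : zs ≡ []
    zs≡[] = proj₂ (unique-split (xs ++ identity (toℕ p)) (suc c ∷ T)
      (subst Unique ends-c u) (trans (sym ends-c) wrap))
      where
      ends-c : α ≡ (xs ++ identity (toℕ p)) ++ c ∷ zs
      ends-c = begin
        α                                           ≡⟨ eq₁ ⟩
        xs ++ identity c ++ zs                      ≡⟨ cong (λ w → xs ++ w ++ zs) (sym (applyUpTo-∷ʳ suc (toℕ p))) ⟩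
        xs ++ (identity (toℕ p) ∷ʳ c) ++ zs         ≡⟨ cong (xs ++_) (++-assoc (identity (toℕ p)) [ c ] zs) ⟩
        xs ++ identity (toℕ p) ++ c ∷ zs            ≡⟨ sym (++-assoc xs _ _) ⟩
        (xs ++ identity (toℕ p)) ++ c ∷ zs          ∎

    α≡xs++ : α ≡ xs ++ identity c
    α≡xs++ = trans eq₁ (cong (xs ++_) (trans (cong (identity c ++_) zs≡[]) (++-identityʳ _)))

    length-xs : length xs ≡ n ∸ c
    length-xs = begin
      length xs                                   ≡⟨ sym (m+n∸n≡m (length xs) c) ⟩
      length xs + c ∸ c                           ≡⟨ cong (λ k → length xs + k ∸ c) (sym (length-applyUpTo suc c)) ⟩
      length xs + length (identity c) ∸ c         ≡⟨ cong (_∸ c) (sym (length-++ xs)) ⟩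
      length (xs ++ identity c) ∸ c               ≡⟨ cong (λ w → length w ∸ c) (sym α≡xs++) ⟩
      length α ∸ c                                ≡⟨ cong (_∸ c) (permutation-length perm) ⟩
      n ∸ c                                       ∎

    xs≡upper : xs ≡ upper (n ∸ c)
    xs≡upper = proj₁ (++-injective xs (upper (n ∸ c))
      (trans length-xs (sym (length-applyUpTo _ (n ∸ c))))
      (trans (sym α≡xs++) (trans eq₂ (cong (λ k → upper k ++ ys) (sym (+-∸-assoc 1 c<n))))))

code⇒wrapped : ∀ {n α} (p : Pointer n) → HasCode n α p → Wrapped (label p) α
code⇒wrapped {n} {α} p code with n ∸ label p in eq
... | zero  = contradiction (m∸n≡0⇒m≤n eq) (<⇒≱ (label<n {n} p))
... | suc k = _ , (begin
  α                                                    ≡⟨ code ⟩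
  suc (c + 0) ∷ upper ++ identity c                    ≡⟨ cong (λ m → suc m ∷ upper ++ identity c) (+-identityʳ c) ⟩
  suc c ∷ upper ++ identity c                          ≡⟨ cong (λ w → suc c ∷ upper ++ w) (sym (applyUpTo-∷ʳ suc (toℕ p))) ⟩
  suc c ∷ upper ++ (identity (toℕ p) ∷ʳ c)             ≡⟨ cong (suc c ∷_) (sym (++-assoc upper _ _)) ⟩
  suc c ∷ (upper ++ identity (toℕ p)) ∷ʳ c             ∎)
  where
  open ≡-Reasoning
  c = label p
  upper = applyUpTo (λ k → suc (c + suc k)) k

-- Every pointer is isolated. At most one is wrapped, since α has only one first entry, and all the
-- others are adjacencies.
fixed-point-form : ∀ {n α} → IsPermutation n α → FixedPoint n α →
  α ≡ identity n ⊎ ∃ λ p → HasCode n α p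
fixed-point-form {n} {α} perm stuck with ∀⊎∃ isolated-pointer
  where
  isolated-pointer : ∀ p → Adjacent (label p) (suc (label p)) α ⊎ Wrapped (label p) α
  isolated-pointer p = isolated perm (s≤s z≤n) (label<n p) (nonInterlocking {p = p} (stuck p))
... | inj₁ adj = inj₁ (all-adjacent⇒identity perm λ 1≤j j<n → adjacent (pointer 1≤j j<n))
  where
  adjacent : ∀ {j} → (∃ λ p → label p ≡ j) → Adjacent j (suc j) α
  adjacent (p , refl) = adj p
... | inj₂ (p , wrap) = inj₂ (p , wrapped⇒code perm p wrap λ {j} 1≤j j<n j≢p → unwrapped 1≤j j<n j≢p)
  where
  unwrapped : ∀ {j} → 1 ≤ j → j < n → j ≢ label p → Adjacent j (suc j) α
  unwrapped 1≤j j<n j≢p with q , refl ← pointer {n} 1≤j j<n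
    with isolated perm (s≤s z≤n) (label<n q) (nonInterlocking {p = q} (stuck q))
  ... | inj₁ adj = adj
  ... | inj₂ (_ , eq) =
    contradiction (suc-injective (∷-injectiveˡ (trans (sym eq) (proj₂ wrap)))) j≢p

-- The alternating path of a wrapped permutation, and uniqueness of paths.

-- The left neighbour of n+1 is the last entry, `label p`; that of the first entry, `suc (label p)`,
-- is 0.
wrapped-path : ∀ {n α} (p : Pointer n) → Wrapped (label p) α →
  CycleGraph.Path n α n (n ∷ label p ∷ 0 ∷ [])
wrapped-path {n} p (T , refl) = step (m<n⇒n≢0 (label<n {n} p)) (≤-refl , refl)
  (0 ∷ suc (label p) ∷ T , [] , cong (λ w → 0 ∷ suc (label p) ∷ w) (++-assoc T _ _))
  (step (λ ()) (<⇒≤ (label<n {n} p) , refl) ([] , _ , refl) stop)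
  where open CycleGraph n _

path-unique : ∀ {n α} → IsPermutation n α → ∀ {k es fs} →
  CycleGraph.Path n α k es → CycleGraph.Path n α k fs → es ≡ fs
path-unique {n} {α} perm = go
  where
  open CycleGraph n α
  go : ∀ {k es fs} → Path k es → Path k fs → es ≡ fs
  go stop stop = refl
  go stop (step k≢0 _ _ _) = contradiction refl k≢0
  go (step k≢0 _ _ _) stop = contradiction refl k≢0
  go (step _ (_ , refl) s π) (step _ (_ , refl) t ρ)
    with refl ← predecessor-unique (unique-frame perm) s t = cong (_ ∷_) (go π ρ)

-- Removing elements from finite subsets.

x∈p─q⇒x∉q : ∀ {m} (p q : Subset m) {x} → x ∈ˢ p ─ q → x ∉ˢ q
x∈p─q⇒x∉q (_ ∷ _) (inside ∷ _) () here
x∈p─q⇒x∉q (_ ∷ p) (_ ∷ q) (there i) (there j) = x∈p─q⇒x∉q p q i j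

x∈p-y⇒x≢y : ∀ {m} (p : Subset m) {x y} → x ∈ˢ p - y → x ≢ y
x∈p-y⇒x≢y p i refl = x∈p─q⇒x∉q p _ i (x∈⁅x⁆ _)

∣p∣≤1+∣p-x∣ : ∀ {m} (p : Subset m) x → ∣ p ∣ ≤ suc ∣ p - x ∣
∣p∣≤1+∣p-x∣ (outside ∷ p) zero = m≤n⇒m≤1+n (≤-reflexive (cong ∣_∣ (sym (p─⊥≡p p))))
∣p∣≤1+∣p-x∣ (inside ∷ p)  zero = s≤s (≤-reflexive (cong ∣_∣ (sym (p─⊥≡p p))))
∣p∣≤1+∣p-x∣ (outside ∷ p) (suc x) = ∣p∣≤1+∣p-x∣ p x
∣p∣≤1+∣p-x∣ (inside ∷ p)  (suc x) = s≤s (∣p∣≤1+∣p-x∣ p x)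

∣p─q∣+∣p∩q∣≡∣p∣ : ∀ {m} (p q : Subset m) → ∣ p ─ q ∣ + ∣ p ∩ q ∣ ≡ ∣ p ∣
∣p─q∣+∣p∩q∣≡∣p∣ []            []            = refl
∣p─q∣+∣p∩q∣≡∣p∣ (outside ∷ p) (outside ∷ q) = ∣p─q∣+∣p∩q∣≡∣p∣ p q
∣p─q∣+∣p∩q∣≡∣p∣ (outside ∷ p) (inside  ∷ q) = ∣p─q∣+∣p∩q∣≡∣p∣ p q
∣p─q∣+∣p∩q∣≡∣p∣ (inside  ∷ p) (outside ∷ q) = cong suc (∣p─q∣+∣p∩q∣≡∣p∣ p q)
∣p─q∣+∣p∩q∣≡∣p∣ (inside  ∷ p) (inside  ∷ q) = trans (+-suc _ _) (cong suc (∣p─q∣+∣p∩q∣≡∣p∣ p q))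

module _ {m} (p : Subset m) (x y : Fin m) where

  ∈-removed⁻ : ∀ {z} → z ∈ˢ p - x - y → z ∈ˢ p × z ≢ x × z ≢ y
  ∈-removed⁻ i = p─q⊆p p _ (p─q⊆p (p - x) _ i) , x∈p-y⇒x≢y p (p─q⊆p (p - x) _ i) , x∈p-y⇒x≢y (p - x) i

  ∈-removed⁺ : ∀ {z} → z ∈ˢ p → z ≢ x → z ≢ y → z ∈ˢ p - x - y
  ∈-removed⁺ i z≢x z≢y = x∈p∧x≢y⇒x∈p-y (x∈p∧x≢y⇒x∈p-y i z≢x) z≢y

  ∣p∣≤2+∣p-x-y∣ : ∣ p ∣ ≤ 2 + ∣ p - x - y ∣
  ∣p∣≤2+∣p-x-y∣ = ≤-trans (∣p∣≤1+∣p-x∣ p x) (s≤s (∣p∣≤1+∣p-x∣ (p - x) y))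

  removed-⊂ : x ∈ˢ p ⊎ y ∈ˢ p → ∣ p - x - y ∣ < ∣ p ∣
  removed-⊂ (inj₁ i) = ≤-<-trans (∣p─q∣≤∣p∣ (p - x) ⁅ y ⁆) (x∈p⇒∣p-x∣<∣p∣ i)
  removed-⊂ (inj₂ i) rewrite p─x─y≡p─y─x p x y =
    ≤-<-trans (∣p─q∣≤∣p∣ (p - y) ⁅ x ⁆) (x∈p⇒∣p-x∣<∣p∣ i)

-- Positions of the game and the effect of a move on the pile.

-- live contains every pointer that can still be moved; it is the termination
-- measure, since a move may leave the pile unchanged.
record Position (n : ℕ) (α : List ℕ) (pile live : Subset (n ∸ 1)) : Set where
  field
    permutation : IsPermutation n α
    unsortable  : ¬ Sortable n α
    isPile      : IsStrategicPile n α pile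
    settled     : ∀ {p} → p ∉ˢ live → Step (Frame n α) (label p) (label p)

module _ {n α pile live} (pos : Position n α pile live) where
  open Position pos
  open CycleGraph n α

  pile⇒path : ∀ {p} → p ∈ˢ pile → ∃ λ es → Path n es × label p ∈ es
  pile⇒path = Equivalence.to (isPile _)

  code∈pile : ∀ {p} → HasCode n α p → p ∈ˢ pile
  code∈pile {p} code = Equivalence.from (isPile p)
    (_ , wrapped-path p (code⇒wrapped {n} p code) , there (here refl))

  stuck⇒code : FixedPoint n α → ∃ λ p → HasCode n α p
  stuck⇒code stuck with fixed-point-form permutation stuck
  ... | inj₁ refl = contradiction ε unsortable
  ... | inj₂ code = code

  interlocks : ∀ {p} → p ∈ˢ pile → 2 ≤ ∣ pile ∣ → ∃ λ q → Interlock p q α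
  interlocks {p} p∈ 2≤ with any? (λ q → interlock? p q α)
  ... | yes q = q
  ... | no none with isolated permutation (s≤s z≤n) (label<n {n} p) (nonInterlocking {p = p} λ q x → none (q , x))
  ... | inj₁ adj = contradiction (proj₂ (proj₂ (pile⇒path p∈)))
    (fixed∉path permutation (λ ()) (adjacent-++ʳ [ 0 ] (adjacent-++ˡ _ adj)) (proj₁ (proj₂ (pile⇒path p∈))))
  ... | inj₂ wrap = contradiction (≤-trans 2≤ (≤-trans (p⊆q⇒∣p∣≤∣q∣ pile⊆⁅p⁆) (≤-reflexive (∣⁅x⁆∣≡1 p)))) λ { (s≤s ()) }
    where
    pile⊆⁅p⁆ : pile ⊆ ⁅ p ⁆
    pile⊆⁅p⁆ {r} r∈ with es , π , r∈es ← pile⇒path r∈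
      with refl ← path-unique permutation π (wrapped-path p wrap) with r∈es
    ... | here r≡n                = contradiction r≡n (<⇒≢ (label<n {n} r))
    ... | there (here r≡p)        = subst (_∈ˢ ⁅ p ⁆) (sym (toℕ-injective (suc-injective r≡p))) (x∈⁅x⁆ p)
    ... | there (there (here ()))

  -- The start n and the remaining labels are outside the excised set, so paths from n transfer in
  -- both directions, while p and q become fixed and drop off the path. Sorting the new permutation
  -- would also sort the old one.
  after-move : ∀ {p q} (x : Interlock p q α) → Position n (cds p q x) (pile - p - q) (live - p - q)
  after-move {p} {q} x = record
    { permutation = E.permutation
    ; unsortable  = λ s → unsortable ((p , q , x , refl) ◅ s)
    ; isPile      = λ r → mk⇔ push-pile pull-pile
    ; settled     = settle
    }
    where
    excision = interlock-excises permutation x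
    module E = Excision excision

    S = OneOf (label p) (label q)

    bounds : ∀ {m} → S m → m ≢ 0 × m ≤ n
    bounds (inj₁ refl) = (λ ()) , <⇒≤ (label<n p)
    bounds (inj₂ refl) = (λ ()) , <⇒≤ (label<n q)

    module T = Transfer permutation excision bounds

    n∉S : ¬ S n
    n∉S (inj₁ n≡p) = <⇒≢ (label<n p) (sym n≡p)
    n∉S (inj₂ n≡q) = <⇒≢ (label<n q) (sym n≡q)

    label∉S : ∀ {r} → r ≢ p → r ≢ q → ¬ S (label r)
    label∉S r≢p _ (inj₁ r≡p) = r≢p (toℕ-injective (suc-injective r≡p))
    label∉S _ r≢q (inj₂ r≡q) = r≢q (toℕ-injective (suc-injective r≡q))

    push-pile : ∀ {r} → r ∈ˢ pile - p - q → ∃ λ es → CycleGraph.Path n (cds p q x) n es × label r ∈ es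
    push-pile r∈ with r∈P , r≢p , r≢q ← ∈-removed⁻ pile p q r∈
      with _ , π , r∈es ← pile⇒path r∈P
      with fs , ρ , sub ← T.push n∉S π = fs , ρ , sub (label∉S r≢p r≢q) r∈es

    pull-pile : ∀ {r} → (∃ λ es → CycleGraph.Path n (cds p q x) n es × label r ∈ es) → r ∈ˢ pile - p - q
    pull-pile {r} (es , π , r∈es) with fs , ρ , sub ← T.pull n∉S π =
      ∈-removed⁺ pile p q (Equivalence.from (isPile r) (fs , ρ , sub r∈es))
        (λ { refl → fixed∉path E.permutation (λ ()) (E.fixed (inj₁ refl)) π r∈es })
        (λ { refl → fixed∉path E.permutation (λ ()) (E.fixed (inj₂ refl)) π r∈es })

    settle : ∀ {r} → r ∉ˢ live - p - q → Step (Frame n (cds p q x)) (label r) (label r)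
    settle {r} r∉ with r Fin.≟ p | r Fin.≟ q
    ... | yes refl | _        = E.fixed (inj₁ refl)
    ... | no _     | yes refl = E.fixed (inj₂ refl)
    ... | no r≢p   | no r≢q   = T.fixed-preserved (<⇒≤ (label<n r)) (label∉S r≢p r≢q)
      (settled λ r∈ → r∉ (∈-removed⁺ live p q r∈ r≢p r≢q))

  unsettled : ∀ {r} → ¬ Step (Frame n α) (label r) (label r) → r ∈ˢ live
  unsettled {r} r-moved with r ∈ˢ? live
  ... | yes r∈ = r∈
  ... | no r∉  = contradiction (settled r∉) r-moved

  -- Pointers outside `live` are fixed, so the one of p and q that was not fixed before the move
  -- belongs to `live` and is removed from it.
  live-decreases : ∀ {p q} → Interlock p q α → ∣ live - p - q ∣ < ∣ live ∣
  live-decreases {p} {q} x with Excision.moved (interlock-excises permutation x)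
  ... | _ , inj₁ refl , p-moved = removed-⊂ live p q (inj₁ (unsettled p-moved))
  ... | _ , inj₂ refl , q-moved = removed-⊂ live p q (inj₂ (unsettled q-moved))

-- The strategy that removes undesired codes.

-- One strategy serves both players: `Bad` holds the codes to be avoided, and `won` turns a fixed
-- point without bad codes in its pile into a win.
module Strategy (n : ℕ) (Won : List ℕ → Set) (Bad : Subset (n ∸ 1))
  (won : ∀ {α pile live} → Position n α pile live → FixedPoint n α →
         (∀ {p} → p ∈ˢ pile → p ∉ˢ Bad) → Won α) where

  bad-removed-⊆ : ∀ (pile : Subset (n ∸ 1)) p q → (pile - p - q) ∩ Bad ⊆ pile ∩ Bad - p
  bad-removed-⊆ pile p q i with r∈ , bad ← x∈p∩q⁻ (pile - p - q) Bad i
    with r∈pile , r≢p , _ ← ∈-removed⁻ pile p q r∈ = x∈p∧x≢y⇒x∈p-y (x∈p∩q⁺ (r∈pile , bad)) r≢p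

  bad-shrinks : ∀ (pile : Subset (n ∸ 1)) p q → ∣ (pile - p - q) ∩ Bad ∣ ≤ ∣ pile ∩ Bad ∣
  bad-shrinks pile p q = p⊆q⇒∣p∣≤∣q∣ (p─q⊆p (pile ∩ Bad) _ ∘ bad-removed-⊆ pile p q)

  bad-removed : ∀ (pile : Subset (n ∸ 1)) p q → p ∈ˢ pile ∩ Bad → ∣ (pile - p - q) ∩ Bad ∣ < ∣ pile ∩ Bad ∣
  bad-removed pile p q p∈ = ≤-<-trans (p⊆q⇒∣p∣≤∣q∣ (bad-removed-⊆ pile p q)) (x∈p⇒∣p-x∣<∣p∣ p∈)

  has-bad : ∀ {pile : Subset (n ∸ 1)} {p} → p ∈ˢ pile ∩ Bad → 4 ≤ 4 * ∣ pile ∩ Bad ∣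
  has-bad p∈ = *-monoʳ-≤ 4 (≤-<-trans z≤n (x∈p⇒∣p-x∣<∣p∣ p∈))

  move? : ∀ α → (∃₂ λ p q → Interlock {n ∸ 1} p q α) ⊎ FixedPoint n α
  move? α with any? (λ p → any? (λ q → interlock? p q α))
  ... | yes (p , q , x) = inj₁ (p , q , x)
  ... | no  none        = inj₂ λ p q x → none (p , q , x)

  mutual
    player : ∀ {α pile live} → Acc _<_ ∣ live ∣ → Position n α pile live →
      4 * ∣ pile ∩ Bad ∣ ≤ 2 + ∣ pile ∣ → PlayerToMove n Won α
    player {α} {pile} (acc rs) pos few with nonempty? (pile ∩ Bad)
    -- A bad code in the pile gives 4 ≤ 2 + |pile|, so the pile has the two elements that removing p
    -- requires.
    ... | yes (p , p∈) with interlocks pos (proj₁ (x∈p∩q⁻ pile Bad p∈)) (+-cancelˡ-≤ 2 _ _ (≤-trans (has-bad p∈) few))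
    ... | q , x = choose (p , q , x , refl) (opponent (rs (live-decreases pos x)) (after-move pos x) few′)
      where
      open ≤-Reasoning
      -- Losing p lowers the left side by at least 4. On the right, the slack of 2 and the at most
      -- two lost elements make up the same 4.
      few′ : 4 * ∣ (pile - p - q) ∩ Bad ∣ ≤ ∣ pile - p - q ∣
      few′ = +-cancelˡ-≤ 4 _ _ (begin
        4 + 4 * ∣ (pile - p - q) ∩ Bad ∣  ≡⟨ sym (*-suc 4 _) ⟩
        4 * suc ∣ (pile - p - q) ∩ Bad ∣  ≤⟨ *-monoʳ-≤ 4 (bad-removed pile p q p∈) ⟩
        4 * ∣ pile ∩ Bad ∣                ≤⟨ few ⟩
        2 + ∣ pile ∣                      ≤⟨ +-monoʳ-≤ 2 (∣p∣≤2+∣p-x-y∣ pile p q) ⟩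
        4 + ∣ pile - p - q ∣              ∎)
    player {α} {pile} (acc rs) pos few | no none with move? α
    ... | inj₂ stuck = over stuck (won pos stuck λ p∈ b → none (_ , x∈p∩q⁺ (p∈ , b)))
    -- With no bad code left any move will do, since none can come back.
    ... | inj₁ (p , q , x) = choose (p , q , x , refl) (opponent (rs (live-decreases pos x)) (after-move pos x)
            (≤-trans (*-monoʳ-≤ 4 still-none) z≤n))
      where
      still-none : ∣ (pile - p - q) ∩ Bad ∣ ≤ 0
      still-none = ≤-trans (bad-shrinks pile p q)
        (≤-reflexive (trans (cong ∣_∣ (Empty-unique none)) (∣⊥∣≡0 (n ∸ 1))))

    opponent : ∀ {α pile live} → Acc _<_ ∣ live ∣ → Position n α pile live →
      4 * ∣ pile ∩ Bad ∣ ≤ ∣ pile ∣ → OpponentToMove n Won α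
    opponent {α} {pile} (acc rs) pos few with move? α
    ... | inj₁ (p , q , x) = answer (λ stuck → stuck p q x) λ where
      -- The opponent removes at most two elements of the pile, which is the slack of 2 in the bound
      -- for `player`.
      (p , q , x , refl) → player (rs (live-decreases pos x)) (after-move pos x)
        (≤-trans (*-monoʳ-≤ 4 (bad-shrinks pile p q)) (≤-trans few (∣p∣≤2+∣p-x-y∣ pile p q)))
    -- A bad code would force a pile of at least four elements, and then its pointer would still
    -- interlock with another.
    ... | inj₂ stuck = over stuck (won pos stuck λ {p} p∈ b →
      let q , x = interlocks pos p∈ (≤-trans (s≤s (s≤s z≤n)) (≤-trans (has-bad (x∈p∩q⁺ (p∈ , b))) few))
      in stuck p q x)

-- The strategy for ONE and for TWO.

module _ {n α} (perm : IsPermutation n α) (unsortable : ¬ Sortable n α) {P : Subset (n ∸ 1)}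
  (isPile : IsStrategicPile n α P) where

  private
    start : Position n α P ⊤
    start = record
      { permutation = perm
      ; unsortable  = unsortable
      ; isPile      = isPile
      ; settled     = λ p∉ → contradiction ∈⊤ p∉
      }

  -- The codes to avoid are those outside `A`. The final fixed point is not the identity, so it has
  -- a code; this lies in the pile and hence in `A`.
  one-wins : ∀ A → 4 * ∣ P ─ A ∣ ≤ 2 + ∣ P ∣ → OneHasWinningStrategy n α A
  one-wins A few = Strategy.player n (CodeIn n A) (∁ A) won (<-wellFounded _) start
    (≤-trans (*-monoʳ-≤ 4 (p⊆q⇒∣p∣≤∣q∣ P∩∁A⊆P─A)) few)
    where
    P∩∁A⊆P─A : P ∩ ∁ A ⊆ P ─ A
    P∩∁A⊆P─A i with r∈P , r∈∁A ← x∈p∩q⁻ P (∁ A) i = x∈p∧x∉q⇒x∈p─q r∈P (x∈∁p⇒x∉p r∈∁A)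

    won : ∀ {β pile live} → Position n β pile live → FixedPoint n β →
      (∀ {p} → p ∈ˢ pile → p ∉ˢ ∁ A) → CodeIn n A β
    won pos stuck good with p , code ← stuck⇒code pos stuck =
      p , x∉∁p⇒x∈p (good (code∈pile pos code)) , code

  two-wins : ∀ A → 4 * ∣ P ∩ A ∣ ≤ ∣ P ∣ → TwoHasWinningStrategy n α A
  two-wins A few = Strategy.opponent n (λ β → ¬ CodeIn n A β) A
    (λ pos _ good (p , p∈A , code) → good (code∈pile pos code) p∈A) (<-wellFounded _) start few

-- The arithmetic of the thresholds.

private
  [m∸m%4]/4≡m/4 : ∀ m → (m ∸ m % 4) / 4 ≡ m / 4
  [m∸m%4]/4≡m/4 m = trans (cong (_/ 4) (trans (cong (_∸ m % 4) (m≡m%n+[m/n]*n m 4)) (m+n∸m≡n (m % 4) (m / 4 * 4))))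
                     (m*n/n≡m (m / 4) 4)

  -- For m = |P| the larger threshold is m minus the quotient `m / 4`, so a set that reaches it
  -- leaves at most `m / 4` undesired codes.
  division : ∀ m → m ≡ 3 * ((m ∸ m % 4) / 4) + m % 4 + m / 4
  division m = trans (m≡m%n+[m/n]*n m 4)
    (trans (regroup (m % 4) (m / 4)) (cong (λ k → 3 * k + m % 4 + m / 4) (sym ([m∸m%4]/4≡m/4 m))))
    where
    regroup : ∀ j k → j + k * 4 ≡ 3 * k + j + k
    regroup = solve-∀

  complement-bound : ∀ {s t c k} → s + t ≡ c + k → c ≤ s → t ≤ k
  complement-bound {s} {t} {c} {k} eq c≤s = +-cancelˡ-≤ c t k (≤-trans (+-monoˡ-≤ t c≤s) (≤-reflexive eq))

  4[m/4]≤m : ∀ m → 4 * (m / 4) ≤ m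
  4[m/4]≤m m = ≤-trans (≤-reflexive (*-comm 4 (m / 4))) (m/n*n≤m m 4)

theorem8 : ∀ (n : ℕ) (α : List ℕ) → IsPermutation n α → ¬ Sortable n α →
    ∀ (P : Subset (n ∸ 1)) → IsStrategicPile n α P →
    ∀ (j : ℕ) → ∣ P ∣ % 4 ≡ j →
    (j < 2 → ∀ (A : Subset (n ∸ 1)) → A ⊆ P →
    ∣ A ∣ ≥ 3 * ((∣ P ∣ ∸ j) / 4) + j →
    OneHasWinningStrategy n α A)
    ×
    (j ≥ 2 → ∀ (A : Subset (n ∸ 1)) → A ⊆ P →
    ∣ A ∣ ≥ 3 * ((∣ P ∣ ∸ j) / 4) + (j ∸ 1) →
    OneHasWinningStrategy n α A)
    ×
    (∀ (A : Subset (n ∸ 1)) → A ⊆ P →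
    ∣ P ─ A ∣ ≥ 3 * ((∣ P ∣ ∸ j) / 4) + j →
    TwoHasWinningStrategy n α A)
theorem8 n α perm unsortable P isPile j refl =
    (λ _ A A⊆P big → one-wins perm unsortable isPile A
      (≤-trans (*-monoʳ-≤ 4 (complement-bound (trans (size A) (division m)) (≤-trans big (A≤P∩A A⊆P))))
        (≤-trans (4[m/4]≤m m) (m≤n+m m 2))))
  , (λ 2≤j A A⊆P big → one-wins perm unsortable isPile A
      (≤-trans (*-monoʳ-≤ 4 (complement-bound (trans (size A) (division′ 2≤j)) (≤-trans big (A≤P∩A A⊆P))))
        (spare 2≤j)))
  , (λ A A⊆P big → two-wins perm unsortable isPile A
      (≤-trans (*-monoʳ-≤ 4 (complement-bound (trans (∣p─q∣+∣p∩q∣≡∣p∣ P A) (division m)) big)) (4[m/4]≤m m)))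
  where
  m = ∣ P ∣

  size : ∀ A → ∣ P ∩ A ∣ + ∣ P ─ A ∣ ≡ m
  size A = trans (+-comm ∣ P ∩ A ∣ ∣ P ─ A ∣) (∣p─q∣+∣p∩q∣≡∣p∣ P A)

  A≤P∩A : ∀ {A} → A ⊆ P → ∣ A ∣ ≤ ∣ P ∩ A ∣
  A≤P∩A A⊆P = p⊆q⇒∣p∣≤∣q∣ λ i → x∈p∩q⁺ (A⊆P i , i)

  -- The threshold of case (1)(b) is lower by one and admits one more undesired code.
  division′ : 2 ≤ m % 4 → m ≡ 3 * ((m ∸ m % 4) / 4) + (m % 4 ∸ 1) + suc (m / 4)
  division′ 2≤j = trans (division m) (trans (cong (λ j → a + j + m / 4) (sym (suc-pred′ 2≤j))) (regroup a (m % 4 ∸ 1) (m / 4)))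
    where
    a = 3 * ((m ∸ m % 4) / 4)
    suc-pred′ : ∀ {j} → 2 ≤ j → suc (j ∸ 1) ≡ j
    suc-pred′ (s≤s _) = refl
    regroup : ∀ a j k → a + suc j + k ≡ a + j + suc k
    regroup = solve-∀

  -- A remainder of at least 2 and the slack of 2 that ONE has by moving first pay for this
  -- additional code.
  spare : 2 ≤ m % 4 → 4 * suc (m / 4) ≤ 2 + m
  spare 2≤j = begin
    4 * suc (m / 4)               ≡⟨ regroup (m / 4) ⟩
    2 + (2 + m / 4 * 4)           ≤⟨ +-monoʳ-≤ 2 (+-monoˡ-≤ (m / 4 * 4) 2≤j) ⟩
    2 + (m % 4 + m / 4 * 4)       ≡⟨ cong (2 +_) (sym (m≡m%n+[m/n]*n m 4)) ⟩
    2 + m                         ∎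
    where
    open ≤-Reasoning
    regroup : ∀ k → 4 * suc k ≡ 2 + (2 + k * 4)
    regroup = solve-∀
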